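{- For $m=5$, the injection $\phi$ from the regions of the inside-out polytope $(\Delta_{4},\mathcal{G}_5)$ to the coherent acyclic orientations of the Golomb graph $\Gamma_5$ is not surjective. In particular, there is no bijection between the coherent acyclic orientations of $\Gamma_5$ and the regions of $(\Delta_4,\mathcal{G}_5)$.
   Context: Notation: $[m]=\{1,\dots,m\}$ and $\Delta_{m-1}=\{\mathbf{z}\in\mathbb{R}^m: z_1,\dots,z_m\ge 0,\ \sum_{i=1}^m z_i=1\}$. A consecutive subset of $[m]$ is a nonempty set of the form $\{j,j+1,\dots,k\}$; it is proper if it is not equal to $[m]$. $\mathcal{G}_m$ is the arrangement of hyperplanes $\sum_{i\in U}z_i=\sum_{i\in V}z_i$, for all pairs of distinct consecutive subsets $U,V$ of $[m]$. A region of $(\Delta_{m-1},\mathcal{G}_m)$ is a connected component of $\Delta_{m-1}\setminus\bigcup_{H\in\mathcal{G}_m}H$. The Golomb graph $\Gamma_m$ is the mixed graph whose vertices are the proper consecutive subsets of $[m]$ and in which every two distinct vertices are joined by one edge: the edge is directed from $U$ to $V$ if $U\subsetneq V$, and all other edges are undirected. An orientation of $\Gamma_m$ assigns a direction to every edge. It is coherent if (a) it is consistent with the directed edges, and (b) whenever $U,V,W$ are pairwise disjoint consecutive sets such that $A=U\cup W$ and $B=V\cup W$ are also (proper) consecutive subsets, then $A\to B$ if and only if $U\to V$. It is acyclic if it has no directed cycle. The map $\phi$ sends a region $R$ to the orientation of $\Gamma_m$ in which $U\to V$ if and only if $\sum_{j\in U}z_j<\sum_{j\in V}z_j$ for all $\mathbf{z}\in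 R$ (for each pair of distinct proper consecutive subsets exactly one of the two strict inequalities holds throughout $R$). This orientation is coherent and acyclic, and $\phi$ is injective. -}

module Defs where

open import Data.Empty using (⊥-elim)
open import Data.Fin.Base as Fin using (Fin; zero; suc)
import Data.Fin.Properties as Fin
open import Data.Fin.Subset as Subset using (Subset; inside; outside)
open import Data.Fin.Subset.Properties using (drop-there)
open import Data.Nat.Base as ℕ using (ℕ; zero; suc)
import Data.Nat.Properties as ℕ
open import Data.Product.Base using (∃; ∃₂; ∃-syntax; _×_; _,_; proj₁; proj₂)
open import Data.Rational.Base as ℚ using (ℚ; 0ℚ; 1ℚ; ½)
import Data.Rational.Properties as ℚ
open import Data.Rational.Solver using (module +-*-Solver)
open import Data.Sum.Base using (_⊎_; inj₁; inj₂)
open import Data.Vec.Base using ([]; _∷_; tabulate; here; there)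
open import Data.Vec.Functional using (Vector; head; tail)
import Data.Vec.Properties as Vec
import Data.Bool.Properties as Bool
open import Function.Bundles using (Func; _⇔_; mk⇔; Equivalence)
open import Function.Construct.Composition using (_⇔-∘_)
open import Function.Construct.Identity using (⇔-id)
open import Function.Construct.Symmetry using (⇔-sym)
open import Level using (0ℓ) renaming (suc to lsuc)
open import Relation.Binary.Bundles using (Setoid)
open import Relation.Binary.Construct.Closure.Transitive
  using (TransClosure; [_]; _∷_)
open import Relation.Binary.Core using (Rel)
open import Relation.Binary.PropositionalEquality
  using (_≡_; _≢_; refl; sym; trans; cong; cong₂; subst; subst₂)
open import Relation.Nullary using (¬_; Dec; does; recompute)
open import Relation.Nullary.Decidable using (_×-dec_)
open import Relation.Unary
  using (Pred; _∈_; _⊆_; _≐_; _∩_; _∪_; _≬_; Satisfiable)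

-- A real number is a rational Cauchy sequence with a modulus; equality of
-- reals is _≈_.  Only the additive ordered structure is needed here.
record ℝ : Set where
  field
    seq    : ℕ → ℚ
    cauchy : ∀ ε → 0ℚ ℚ.< ε → ∃[ N ] ∀ i j → N ℕ.≤ i → N ℕ.≤ j →
             ℚ.∣ seq i ℚ.- seq j ∣ ℚ.< ε

open ℝ public

Eventually : Pred ℕ 0ℓ → Set
Eventually P = ∃[ N ] ∀ n → N ℕ.≤ n → P n

infix 4 _<_ _≤_ _≈_ _#_

_<_ : Rel ℝ 0ℓ
x < y = ∃[ ε ] 0ℚ ℚ.< ε × Eventually (λ n → seq x n ℚ.+ ε ℚ.≤ seq y n)

_≤_ : Rel ℝ 0ℓ
x ≤ y = ∀ ε → 0ℚ ℚ.< ε → Eventually (λ n → seq x n ℚ.≤ seq y n ℚ.+ ε)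

_≈_ : Rel ℝ 0ℓ
x ≈ y = x ≤ y × y ≤ x

-- Constructive inequality (apartness); classically the negation of _≈_.
_#_ : Rel ℝ 0ℓ
x # y = x < y ⊎ y < x

fromℚ : ℚ → ℝ
fromℚ q .seq _ = q
fromℚ q .cauchy ε 0<ε = 0 , λ _ _ _ _ →
  subst (λ r → ℚ.∣ r ∣ ℚ.< ε) (sym (ℚ.+-inverseʳ q)) 0<ε

0ℝ 1ℝ : ℝ
0ℝ = fromℚ 0ℚ
1ℝ = fromℚ 1ℚ

abstract

  half : ℚ → ℚ
  half ε = ½ ℚ.* ε

  half+half : ∀ ε → half ε ℚ.+ half ε ≡ ε
  half+half = solve 1 (λ e → con ½ :* e :+ con ½ :* e := e) refl
    where open +-*-Solver

  half-pos : ∀ {ε} → 0ℚ ℚ.< ε → 0ℚ ℚ.< half ε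
  half-pos {ε} 0<ε =
    subst (ℚ._< ½ ℚ.* ε) (ℚ.*-zeroʳ ½) (ℚ.*-monoʳ-<-pos ½ 0<ε)

p≤p+ε : ∀ p {ε} → 0ℚ ℚ.< ε → p ℚ.≤ p ℚ.+ ε
p≤p+ε p {ε} 0<ε =
  subst (ℚ._≤ p ℚ.+ ε) (ℚ.+-identityʳ p) (ℚ.+-monoʳ-≤ p (ℚ.<⇒≤ 0<ε))

half≤ : ∀ {ε} → 0ℚ ℚ.< ε → half ε ℚ.≤ ε
half≤ {ε} 0<ε =
  subst (half ε ℚ.≤_) (half+half ε) (p≤p+ε (half ε) (half-pos 0<ε))

eventually₂ : ∀ {P Q R : Pred ℕ 0ℓ} → (∀ n → P n → Q n → R n) →
              Eventually P → Eventually Q → Eventually R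
eventually₂ f (M , p) (N , q) = M ℕ.⊔ N , λ n M⊔N≤n →
  f n (p n (ℕ.m⊔n≤o⇒m≤o M N M⊔N≤n)) (q n (ℕ.m⊔n≤o⇒n≤o M N M⊔N≤n))

infixl 6 _+_

_+_ : ℝ → ℝ → ℝ
(x + y) .seq n = seq x n ℚ.+ seq y n
(x + y) .cauchy ε 0<ε with cauchy x (half ε) (half-pos 0<ε)
                         | cauchy y (half ε) (half-pos 0<ε)
... | M , p | N , q = M ℕ.⊔ N , λ i j i≥ j≥ → begin-strict
  ℚ.∣ (seq x i ℚ.+ seq y i) ℚ.- (seq x j ℚ.+ seq y j) ∣
    ≡⟨ cong ℚ.∣_∣ (rearrange (seq x i) (seq y i) (seq x j) (seq y j)) ⟩
  ℚ.∣ (seq x i ℚ.- seq x j) ℚ.+ (seq y i ℚ.- seq y j) ∣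
    ≤⟨ ℚ.∣p+q∣≤∣p∣+∣q∣ (seq x i ℚ.- seq x j) (seq y i ℚ.- seq y j) ⟩
  ℚ.∣ seq x i ℚ.- seq x j ∣ ℚ.+ ℚ.∣ seq y i ℚ.- seq y j ∣
    <⟨ ℚ.+-mono-< (p i j (ℕ.m⊔n≤o⇒m≤o M N i≥) (ℕ.m⊔n≤o⇒m≤o M N j≥))
                  (q i j (ℕ.m⊔n≤o⇒n≤o M N i≥) (ℕ.m⊔n≤o⇒n≤o M N j≥)) ⟩
  half ε ℚ.+ half ε
    ≡⟨ half+half ε ⟩
  ε ∎
  where
  open ℚ.≤-Reasoning
  open +-*-Solver
  rearrange : ∀ a b c d →
    (a ℚ.+ b) ℚ.- (c ℚ.+ d) ≡ (a ℚ.- c) ℚ.+ (b ℚ.- d)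
  rearrange = solve 4 (λ a b c d →
    (a :+ b) :- (c :+ d) := (a :- c) :+ (b :- d)) refl

<-trans : ∀ {x y z} → x < y → y < z → x < z
<-trans {x} {y} {z} (ε , 0<ε , x<y) (δ , 0<δ , y<z) =
  ε , 0<ε , eventually₂ {R = λ n → seq x n ℚ.+ ε ℚ.≤ seq z n}
    (λ n p q → ℚ.≤-trans p (ℚ.≤-trans (p≤p+ε (seq y n) 0<δ) q)) x<y y<z

≤⇒≯ : ∀ {x y} → x ≤ y → ¬ y < x
≤⇒≯ {x} {y} x≤y (ε , 0<ε , y<x)
  with x≤y (half ε) (half-pos 0<ε)
... | M , p with y<x
... | N , q = ℚ.<-irrefl refl (begin-strict
  seq y n ℚ.+ half ε
    <⟨ ℚ.+-monoʳ-< (seq y n) half<ε ⟩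
  seq y n ℚ.+ ε
    ≤⟨ q n (ℕ.m≤n⊔m M N) ⟩
  seq x n
    ≤⟨ p n (ℕ.m≤m⊔n M N) ⟩
  seq y n ℚ.+ half ε ∎)
  where
  open ℚ.≤-Reasoning
  n = M ℕ.⊔ N
  half<ε : half ε ℚ.< ε
  half<ε = subst₂ ℚ._<_ (ℚ.+-identityʳ (half ε)) (half+half ε)
             (ℚ.+-monoʳ-< (half ε) (half-pos 0<ε))

≤-refl : ∀ {x} → x ≤ x
≤-refl {x} ε 0<ε = 0 , λ n _ → p≤p+ε (seq x n) 0<ε

<⇒≤ : ∀ {x y} → x < y → x ≤ y
<⇒≤ {x} {y} (ε , 0<ε , N , p) δ 0<δ = N , λ n N≤n →
  ℚ.≤-trans (p≤p+ε (seq x n) 0<ε)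
    (ℚ.≤-trans (p n N≤n) (p≤p+ε (seq y n) 0<δ))

<-irrefl : ∀ {x} → ¬ x < x
<-irrefl {x} = ≤⇒≯ {x} {x} (≤-refl {x})

<-asym : ∀ {x y} → x < y → ¬ y < x
<-asym {x} {y} x<y = ≤⇒≯ {x} {y} (<⇒≤ {x} {y} x<y)

interchange : ∀ a b c d →
  (a ℚ.+ b) ℚ.+ (c ℚ.+ d) ≡ (a ℚ.+ c) ℚ.+ (b ℚ.+ d)
interchange = solve 4 (λ a b c d →
  (a :+ b) :+ (c :+ d) := (a :+ c) :+ (b :+ d)) refl
  where open +-*-Solver

+-mono-≤ : ∀ {x y u v} → x ≤ y → u ≤ v → x + u ≤ y + v
+-mono-≤ {x} {y} {u} {v} x≤y u≤v ε 0<ε =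
  eventually₂ {R = λ n → seq (x + u) n ℚ.≤ seq (y + v) n ℚ.+ ε}
    (λ n p q → ℚ.≤-trans (ℚ.+-mono-≤ p q) (ℚ.≤-reflexive
      (trans (interchange (seq y n) (half ε) (seq v n) (half ε))
             (cong (seq (y + v) n ℚ.+_) (half+half ε)))))
    (x≤y (half ε) (half-pos 0<ε)) (u≤v (half ε) (half-pos 0<ε))

Point : ℕ → Set
Point m = Vector ℝ m

-- w lies in the open ε-ball around z for the maximum norm.
Near : ∀ {m} → ℚ → Point m → Point m → Set
Near ε z w = ∀ i → w i < z i + fromℚ ε × z i < w i + fromℚ ε

Open : ∀ {m} → Pred (Point m) 0ℓ → Set
Open A = ∀ {z} → z ∈ A → ∃[ ε ] 0ℚ ℚ.< ε × (∀ w → Near ε z w → w ∈ A)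

-- Two open sets that cover C and both meet C meet inside C.
Connected : ∀ {m} → Pred (Point m) 0ℓ → Set₁
Connected C = ∀ A B → Open A → Open B → C ⊆ A ∪ B → C ≬ A → C ≬ B →
              C ≬ (A ∩ B)

record IsComponent {m} (X C : Pred (Point m) 0ℓ) : Set₁ where
  field
    inhabited : Satisfiable C
    contained : C ⊆ X
    connected : Connected C
    maximal   : ∀ D → D ⊆ X → Connected D → C ⊆ D → D ⊆ C

[_⋯_] : ∀ {m} → Fin m → Fin m → Subset m
[ j ⋯ k ] = tabulate λ i → does ((j Fin.≤? i) ×-dec (i Fin.≤? k))

Consecutive : ∀ {m} → Pred (Subset m) 0ℓ
Consecutive S = ∃₂ λ j k → j Fin.≤ k × S ≡ [ j ⋯ k ]

consecutive? : ∀ {m} (S : Subset m) → Dec (Consecutive S)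
consecutive? S = Fin.any? λ j → Fin.any? λ k →
  (j Fin.≤? k) ×-dec Vec.≡-dec Bool._≟_ S [ j ⋯ k ]

-- The proofs are irrelevant, so _≡_ on this type is equality of sets.
record ProperConsecutive (m : ℕ) : Set where
  constructor mkPC
  field
    set          : Subset m
    .consecutive : Consecutive set
    .proper      : set ≢ Subset.⊤

open ProperConsecutive public using (set)

∑[_] : ∀ {m} → Subset m → Point m → ℝ
∑[ []          ] z = 0ℝ
∑[ inside  ∷ S ] z = head z + ∑[ S ] (tail z)
∑[ outside ∷ S ] z = ∑[ S ] (tail z)

Simplex : ∀ m → Pred (Point m) 0ℓ
Simplex m z = (∀ i → 0ℝ ≤ z i) × ∑[ Subset.⊤ ] z ≈ 1ℝ

-- Lying off a hyperplane is expressed by apartness of the two sums.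
OffHyperplanes : ∀ m → Pred (Point m) 0ℓ
OffHyperplanes m z = ∀ {U V} → Consecutive U → Consecutive V → U ≢ V →
                     ∑[ U ] z # ∑[ V ] z

record Region (m : ℕ) : Set₁ where
  field
    carrier     : Pred (Point m) 0ℓ
    isComponent : IsComponent (Simplex m ∩ OffHyperplanes m) carrier

  open IsComponent isComponent public

open Region public using (carrier)

Regions : ℕ → Setoid (lsuc 0ℓ) 0ℓ
Regions m = record
  { Carrier = Region m
  ; _≈_     = λ R R′ → carrier R ≐ carrier R′
  ; isEquivalence = record
    { refl  = (λ z → z) , (λ z → z)
    ; sym   = λ (f , g) → g , f
    ; trans = λ (f , g) (h , k) → (λ z → h (f z)) , (λ z → g (k z))
    }
  }

-- The edge joining two adjacent vertices is directed from u to v if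
-- Directed u v, and undirected if neither Directed u v nor Directed v u.
record MixedGraph : Set₁ where
  field
    Vertex   : Set
    Adjacent : Rel Vertex 0ℓ
    Directed : Rel Vertex 0ℓ

record Orientation (G : MixedGraph) : Set₁ where
  open MixedGraph G
  infix 4 _⟶_
  field
    _⟶_      : Rel Vertex 0ℓ
    adjacent : ∀ {u v} → u ⟶ v → Adjacent u v
    total    : ∀ {u v} → Adjacent u v → u ⟶ v ⊎ v ⟶ u
    asym     : ∀ {u v} → u ⟶ v → ¬ v ⟶ u

Consistent : ∀ {G} → Orientation G → Set
Consistent {G} o = ∀ {u v} → Directed u v → u ⟶ v
  where open MixedGraph G; open Orientation o

-- A closed directed walk contains a directed cycle.
Acyclic : ∀ {G} → Orientation G → Set
Acyclic o = ∀ {u} → ¬ TransClosure _⟶_ u u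
  where open Orientation o

Golomb : ℕ → MixedGraph
Golomb m = record
  { Vertex   = ProperConsecutive m
  ; Adjacent = _≢_
  ; Directed = λ U V → set U Subset.⊂ set V
  }

Disjoint : ∀ {m} → Rel (Subset m) 0ℓ
Disjoint S T = Subset.Empty (S Subset.∩ T)

-- U, V and W are automatically proper, being contained in A or B.
record Coherent {m} (o : Orientation (Golomb m)) : Set where
  open Orientation o
  field
    consistent : Consistent o
    cancel     : ∀ {U V W A B : ProperConsecutive m} →
                 Disjoint (set U) (set V) →
                 Disjoint (set U) (set W) →
                 Disjoint (set V) (set W) →
                 set A ≡ set U Subset.∪ set W →
                 set B ≡ set V Subset.∪ set W →
                 (A ⟶ B) ⇔ (U ⟶ V)

record CoherentAcyclicOrientation (m : ℕ) : Set₁ where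
  field
    orientation : Orientation (Golomb m)
    coherent    : Coherent orientation
    acyclic     : Acyclic orientation

  open Orientation orientation public

CoherentAcyclicOrientations : ℕ → Setoid (lsuc 0ℓ) 0ℓ
CoherentAcyclicOrientations m = record
  { Carrier = CoherentAcyclicOrientation m
  ; _≈_     = λ o o′ → ∀ U V → (o ⟨ U ⟶ V ⟩) ⇔ (o′ ⟨ U ⟶ V ⟩)
  ; isEquivalence = record
    { refl  = λ U V → ⇔-id _
    ; sym   = λ e U V → ⇔-sym (e U V)
    ; trans = λ e e′ U V → e′ U V ⇔-∘ e U V
    }
  }
  where
  _⟨_⟶_⟩ : CoherentAcyclicOrientation m → Rel (ProperConsecutive m) 0ℓ
  o ⟨ U ⟶ V ⟩ = CoherentAcyclicOrientation._⟶_ o U V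

∑-⊆ : ∀ {m} (S T : Subset m) {z : Point m} → (∀ i → 0ℝ ≤ z i) →
      S Subset.⊆ T → ∑[ S ] z ≤ ∑[ T ] z
∑-⊆ [] [] z≥0 S⊆T = ≤-refl {0ℝ}
∑-⊆ (outside ∷ S) (outside ∷ T) z≥0 S⊆T =
  ∑-⊆ S T (λ i → z≥0 (suc i)) (λ x∈S → drop-there (S⊆T (there x∈S)))
∑-⊆ (outside ∷ S) (inside ∷ T) {z} z≥0 S⊆T ε 0<ε =
  let N , p = +-mono-≤ {0ℝ} {head z} {∑[ S ] (tail z)} {∑[ T ] (tail z)}
                (z≥0 zero)
                (∑-⊆ S T (λ i → z≥0 (suc i))
                  (λ x∈S → drop-there (S⊆T (there x∈S))))
                ε 0<ε
  in N , λ n N≤n →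
    subst (ℚ._≤ seq (∑[ inside ∷ T ] z) n ℚ.+ ε)
      (ℚ.+-identityˡ (seq (∑[ S ] (tail z)) n)) (p n N≤n)
∑-⊆ (inside ∷ S) (outside ∷ T) z≥0 S⊆T with () ← S⊆T here
∑-⊆ (inside ∷ S) (inside ∷ T) {z} z≥0 S⊆T =
  +-mono-≤ {head z} {head z} {∑[ S ] (tail z)} {∑[ T ] (tail z)}
    (≤-refl {head z})
    (∑-⊆ S T (λ i → z≥0 (suc i)) (λ x∈S → drop-there (S⊆T (there x∈S))))

drop-disjoint : ∀ {m} s t (S T : Subset m) →
                Disjoint (s ∷ S) (t ∷ T) → Disjoint S T
drop-disjoint s t S T d (x , x∈) = d (suc x , there x∈)

∑-∪ : ∀ {m} (S T : Subset m) (z : Point m) → Disjoint S T → ∀ n →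
      seq (∑[ S Subset.∪ T ] z) n ≡ seq (∑[ S ] z) n ℚ.+ seq (∑[ T ] z) n
∑-∪ [] [] z d n = refl
∑-∪ (outside ∷ S) (outside ∷ T) z d n =
  ∑-∪ S T (tail z) (drop-disjoint outside outside S T d) n
∑-∪ (outside ∷ S) (inside ∷ T) z d n =
  trans (cong (seq (head z) n ℚ.+_)
               (∑-∪ S T (tail z) (drop-disjoint outside inside S T d) n))
        (swap (seq (head z) n)
              (seq (∑[ S ] (tail z)) n) (seq (∑[ T ] (tail z)) n))
  where
  open +-*-Solver
  swap : ∀ a b c → a ℚ.+ (b ℚ.+ c) ≡ b ℚ.+ (a ℚ.+ c)
  swap = solve 3 (λ a b c → a :+ (b :+ c) := b :+ (a :+ c)) refl
∑-∪ (inside ∷ S) (outside ∷ T) z d n =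
  trans (cong (seq (head z) n ℚ.+_)
               (∑-∪ S T (tail z) (drop-disjoint inside outside S T d) n))
        (sym (ℚ.+-assoc (seq (head z) n)
               (seq (∑[ S ] (tail z)) n) (seq (∑[ T ] (tail z)) n)))
∑-∪ (inside ∷ S) (inside ∷ T) z d n = ⊥-elim (d (zero , here))

<-cancel : ∀ {a b u v w} →
           (∀ n → seq a n ≡ seq u n ℚ.+ seq w n) →
           (∀ n → seq b n ≡ seq v n ℚ.+ seq w n) →
           (a < b) ⇔ (u < v)
<-cancel {a} {b} {u} {v} {w} a≡u+w b≡v+w = mk⇔
  (λ (ε , 0<ε , N , p) → ε , 0<ε , N , λ n N≤n →
    subst₂ ℚ._≤_ (cancel (seq u n) (seq w n) ε) (cancel′ (seq v n) (seq w n))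
      (ℚ.+-monoˡ-≤ (ℚ.- seq w n)
        (subst₂ (λ r s → r ℚ.+ ε ℚ.≤ s) (a≡u+w n) (b≡v+w n) (p n N≤n))))
  (λ (ε , 0<ε , N , p) → ε , 0<ε , N , λ n N≤n →
    subst₂ (λ r s → r ℚ.+ ε ℚ.≤ s) (sym (a≡u+w n)) (sym (b≡v+w n))
      (subst (ℚ._≤ seq v n ℚ.+ seq w n) (swap (seq u n) ε (seq w n))
        (ℚ.+-monoˡ-≤ (seq w n) (p n N≤n))))
  where
  open +-*-Solver
  cancel : ∀ p q e → ((p ℚ.+ q) ℚ.+ e) ℚ.- q ≡ p ℚ.+ e
  cancel = solve 3 (λ p q e → ((p :+ q) :+ e) :- q := p :+ e) refl
  cancel′ : ∀ p q → (p ℚ.+ q) ℚ.- q ≡ p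
  cancel′ = solve 2 (λ p q → (p :+ q) :- q := p) refl
  swap : ∀ p e q → (p ℚ.+ e) ℚ.+ q ≡ (p ℚ.+ q) ℚ.+ e
  swap = solve 3 (λ p e q → (p :+ e) :+ q := (p :+ q) :+ e) refl

-- Changing each of m coordinates by at most radius m ε changes every
-- partial sum by at most ε.
radius : ℕ → ℚ → ℚ
radius zero    ε = ε
radius (suc m) ε = radius m (half ε)

radius-pos : ∀ m {ε} → 0ℚ ℚ.< ε → 0ℚ ℚ.< radius m ε
radius-pos zero    0<ε = 0<ε
radius-pos (suc m) 0<ε = radius-pos m (half-pos 0<ε)

radius≤ : ∀ m {ε} → 0ℚ ℚ.< ε → radius m ε ℚ.≤ ε
radius≤ zero    0<ε = ℚ.≤-refl
radius≤ (suc m) 0<ε = ℚ.≤-trans (radius≤ m (half-pos 0<ε)) (half≤ 0<ε)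

∑-continuous : ∀ {m} (S : Subset m) {z w : Point m} {ε} → 0ℚ ℚ.< ε →
  (∀ i → w i < z i + fromℚ (radius m ε)) →
  Eventually (λ n → seq (∑[ S ] w) n ℚ.≤ seq (∑[ S ] z) n ℚ.+ ε)
∑-continuous [] 0<ε near = 0 , λ n _ → p≤p+ε 0ℚ 0<ε
∑-continuous (outside ∷ S) {z} {w} 0<ε near =
  let N , p = ∑-continuous S {tail z} {tail w} (half-pos 0<ε)
                (λ i → near (suc i))
  in N , λ n N≤n → ℚ.≤-trans (p n N≤n)
    (ℚ.+-monoʳ-≤ (seq (∑[ S ] (tail z)) n) (half≤ 0<ε))
∑-continuous {suc m} (inside ∷ S) {z} {w} {ε} 0<ε near =
  let δ , 0<δ , near₀ = near zero in
  eventually₂ {R = λ n → seq (∑[ inside ∷ S ] w) n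
                           ℚ.≤ seq (∑[ inside ∷ S ] z) n ℚ.+ ε}
    (λ n p q → begin
      seq (w zero) n ℚ.+ seq (∑[ S ] (tail w)) n
        ≤⟨ ℚ.+-mono-≤ (ℚ.≤-trans (p≤p+ε (seq (w zero) n) 0<δ) p) q ⟩
      (seq (z zero) n ℚ.+ radius m (half ε))
        ℚ.+ (seq (∑[ S ] (tail z)) n ℚ.+ half ε)
        ≤⟨ ℚ.+-monoˡ-≤ (seq (∑[ S ] (tail z)) n ℚ.+ half ε)
             (ℚ.+-monoʳ-≤ (seq (z zero) n)
             (radius≤ m (half-pos 0<ε))) ⟩
      (seq (z zero) n ℚ.+ half ε)
        ℚ.+ (seq (∑[ S ] (tail z)) n ℚ.+ half ε)
        ≡⟨ interchange (seq (z zero) n) (half ε)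
             (seq (∑[ S ] (tail z)) n) (half ε) ⟩
      (seq (z zero) n ℚ.+ seq (∑[ S ] (tail z)) n)
        ℚ.+ (half ε ℚ.+ half ε)
        ≡⟨ cong (seq (∑[ inside ∷ S ] z) n ℚ.+_) (half+half ε) ⟩
      seq (∑[ inside ∷ S ] z) n ℚ.+ ε ∎)
    near₀
    (∑-continuous S {tail z} {tail w} (half-pos 0<ε) (λ i → near (suc i)))
  where open ℚ.≤-Reasoning

∑<∑-open : ∀ {m} (S T : Subset m) → Open (λ z → ∑[ S ] z < ∑[ T ] z)
∑<∑-open {m} S T {z} (ε , 0<ε , gap) =
  radius m η , radius-pos m 0<η , λ w near →
    h , 0<h ,
    eventually₂ {R = λ n → seq (∑[ S ] w) n ℚ.+ h ℚ.≤ seq (∑[ T ] w) n}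
      (λ n p (q , r) → cancel-≤ η (begin
        (seq (∑[ S ] w) n ℚ.+ h) ℚ.+ η
          ≤⟨ ℚ.+-monoˡ-≤ η (ℚ.+-monoˡ-≤ h q) ⟩
        ((seq (∑[ S ] z) n ℚ.+ η) ℚ.+ h) ℚ.+ η
          ≡⟨ regroup (seq (∑[ S ] z) n) ⟩
        seq (∑[ S ] z) n ℚ.+ ε
          ≤⟨ p ⟩
        seq (∑[ T ] z) n
          ≤⟨ r ⟩
        seq (∑[ T ] w) n ℚ.+ η ∎))
      gap
      (eventually₂ (λ n q r → q , r)
        (∑-continuous S {z} {w} 0<η (λ i → proj₁ (near i)))
        (∑-continuous T {w} {z} 0<η (λ i → proj₂ (near i))))
  where
  open ℚ.≤-Reasoning
  open +-*-Solver
  h = half ε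
  η = half h
  0<h = half-pos 0<ε
  0<η = half-pos 0<h
  regroup : ∀ a → ((a ℚ.+ η) ℚ.+ h) ℚ.+ η ≡ a ℚ.+ ε
  regroup a = trans (shuffle a η h)
    (cong (a ℚ.+_) (trans (cong (h ℚ.+_) (half+half h)) (half+half ε)))
    where
    shuffle : ∀ a p q → ((a ℚ.+ p) ℚ.+ q) ℚ.+ p ≡ a ℚ.+ (q ℚ.+ (p ℚ.+ p))
    shuffle = solve 3 (λ a p q →
      ((a :+ p) :+ q) :+ p := a :+ (q :+ (p :+ p))) refl
  cancel′ : ∀ p q → (p ℚ.+ q) ℚ.- q ≡ p
  cancel′ = solve 2 (λ p q → (p :+ q) :- q := p) refl
  cancel-≤ : ∀ {p q} r → p ℚ.+ r ℚ.≤ q ℚ.+ r → p ℚ.≤ q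
  cancel-≤ {p} {q} r p+r≤q+r =
    subst₂ ℚ._≤_ (cancel′ p r) (cancel′ q r) (ℚ.+-monoˡ-≤ (ℚ.- r) p+r≤q+r)

module _ {m : ℕ} (R : Region m) where

  open Region R using (inhabited; contained; connected)

  infix 4 _⟶ᴿ_

  _⟶ᴿ_ : Rel (ProperConsecutive m) 0ℓ
  U ⟶ᴿ V = ∀ z → z ∈ carrier R → ∑[ set U ] z < ∑[ set V ] z

  apart : ∀ U V → U ≢ V → ∀ {z} → z ∈ carrier R →
          ∑[ set U ] z # ∑[ set V ] z
  apart (mkPC U cU pU) (mkPC V cV pV) U≢V z∈R =
    proj₂ (contained z∈R) (recompute (consecutive? U) cU)
      (recompute (consecutive? V) cV) λ { refl → U≢V refl }

  spread : ∀ U V → U ≢ V → ∀ {z} → z ∈ carrier R →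
           ∑[ set U ] z < ∑[ set V ] z → U ⟶ᴿ V
  spread U V U≢V {z} z∈R z< w w∈R with apart U V U≢V w∈R
  ... | inj₁ w< = w<
  ... | inj₂ w>
    with connected _ _ (∑<∑-open (set U) (set V)) (∑<∑-open (set V) (set U))
           (apart U V U≢V) (z , z∈R , z<) (w , w∈R , w>)
  ... | v , _ , v< , v> =
    ⊥-elim (<-asym {∑[ set U ] v} {∑[ set V ] v} v< v>)

  φ-orientation : Orientation (Golomb m)
  φ-orientation = record
    { _⟶_      = _⟶ᴿ_
    ; adjacent = λ { {U} U⟶U refl → let z , z∈R = inhabited in
                     <-irrefl {∑[ set U ] z} (U⟶U z z∈R) }
    ; total    = λ {U} {V} → total {U} {V}
    ; asym     = λ {U} {V} U⟶V V⟶U → let z , z∈R = inhabited in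
                   <-asym {∑[ set U ] z} {∑[ set V ] z} (U⟶V z z∈R) (V⟶U z z∈R)
    }
    where
    total : ∀ {U V} → U ≢ V → U ⟶ᴿ V ⊎ V ⟶ᴿ U
    total {U} {V} U≢V with inhabited
    ... | z , z∈R with apart U V U≢V z∈R
    ... | inj₁ z< = inj₁ (spread U V U≢V z∈R z<)
    ... | inj₂ z> = inj₂ (spread V U (λ V≡U → U≢V (sym V≡U)) z∈R z>)

  φ-coherent : Coherent φ-orientation
  φ-coherent = record
    { consistent = λ {U} {V} → consistent {U} {V}
    ; cancel = λ {U} {V} {W} {A} {B} → cancel {U} {V} {W} {A} {B}
    }
    where
    consistent : ∀ {U V} → set U Subset.⊂ set V → U ⟶ᴿ V
    consistent {U} {V} (U⊆V , x , x∈V , x∉U) z z∈R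
      with apart U V (λ { refl → x∉U x∈V }) z∈R
    ... | inj₁ z< = z<
    ... | inj₂ z> = ⊥-elim (≤⇒≯ {∑[ set U ] z} {∑[ set V ] z}
            (∑-⊆ (set U) (set V) (proj₁ (proj₁ (contained z∈R))) U⊆V) z>)

    cancel : ∀ {U V W A B} →
      Disjoint (set U) (set V) → Disjoint (set U) (set W) →
      Disjoint (set V) (set W) →
      set A ≡ set U Subset.∪ set W → set B ≡ set V Subset.∪ set W →
      (A ⟶ᴿ B) ⇔ (U ⟶ᴿ V)
    cancel {U} {V} {W} {A} {B} _ U∩W V∩W A≡ B≡ = mk⇔
      (λ A⟶B z z∈R → Equivalence.to (at z) (A⟶B z z∈R))
      (λ U⟶V z z∈R → Equivalence.from (at z) (U⟶V z z∈R))
      where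
      at : ∀ z → (∑[ set A ] z < ∑[ set B ] z) ⇔ (∑[ set U ] z < ∑[ set V ] z)
      at z = subst₂
        (λ S T → (∑[ S ] z < ∑[ T ] z) ⇔ (∑[ set U ] z < ∑[ set V ] z))
        (sym A≡) (sym B≡)
        (<-cancel {∑[ set U Subset.∪ set W ] z} {∑[ set V Subset.∪ set W ] z}
          {∑[ set U ] z} {∑[ set V ] z} {∑[ set W ] z}
          (∑-∪ (set U) (set W) z U∩W) (∑-∪ (set V) (set W) z V∩W))

  φ-acyclic : Acyclic φ-orientation
  φ-acyclic {U} U⟶⁺U = let z , z∈R = inhabited in
    <-irrefl {∑[ set U ] z} (walk U⟶⁺U z z∈R)
    where
    walk : ∀ {U V} → TransClosure _⟶ᴿ_ U V → U ⟶ᴿ V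
    walk [ U⟶V ] = U⟶V
    walk {U} {W} (_∷_ {y = V} U⟶V V⟶⁺W) z z∈R =
      <-trans {∑[ set U ] z} {∑[ set V ] z} {∑[ set W ] z}
        (U⟶V z z∈R) (walk V⟶⁺W z z∈R)

φ : ∀ m → Func (Regions m) (CoherentAcyclicOrientations m)
φ m = record
  { to   = λ R → record
    { orientation = φ-orientation R
    ; coherent    = φ-coherent R
    ; acyclic     = φ-acyclic R
    }
  ; cong = λ (R⊆R′ , R′⊆R) U V → mk⇔
      (λ U⟶V z z∈R′ → U⟶V z (R′⊆R z∈R′))
      (λ U⟶V z z∈R → U⟶V z (R⊆R′ z∈R))
  }

{-# OPTIONS --safe #-}
module Submission where

-- Coherence relates the comparison of two disjoint intervals to another one only
-- when both can be enlarged by a common interval disjoint from them, so it says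
-- nothing about complementary pairs such as {1,2,3} and {4,5}.  Exchanging these
-- two, when they are neighbours in the order of the interval sums at a point z
-- with z₄ < z₃ and z₅ < z₁ + z₂, gives a coherent acyclic orientation that no
-- point realizes.
--
-- A region is the whole cell cut out by its strict inequalities, because a cell
-- is convex, hence connected; so φ is injective.  A bijection f from the
-- orientations to the regions would therefore make φ ∘ f an injective self-map
-- of a finite setoid, and some pair of iterates on y collides by the pigeonhole
-- principle.  Hence φ ∘ f, and with it φ, would be surjective.

open import Defs
import Data.Bool.Properties as Bool
open import Data.Empty using (⊥-elim; ⊥-elim-irr)
open import Data.Fin.Base as Fin using (Fin; zero; suc; toℕ; funToFin)
import Data.Fin.Properties as Fin
open import Data.Fin.Patterns using (0F; 1F; 2F; 3F; 4F)
open import Data.Fin.Subset as Subset using (Subset; inside; outside)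
import Data.Fin.Subset.Properties as Subset
import Data.Integer.Base as ℤ
import Data.Integer.Properties as ℤ
open import Data.Nat.Base as ℕ using (ℕ; zero; suc)
open import Data.Nat.GeneralisedArithmetic using (fold)
import Data.Nat.Properties as ℕ
open import Data.Product.Base using (Σ; ∃₂; ∃-syntax; _×_; _,_; proj₁; proj₂)
open import Data.Rational.Base as ℚ using (ℚ; mkℚ; 0ℚ; 1ℚ)
import Data.Rational.Properties as ℚ
import Data.Rational.Unnormalised.Base as ℚᵘ
open ℚᵘ using (mkℚᵘ)
import Data.Rational.Unnormalised.Properties as ℚᵘ
open import Data.Rational.Solver using (module +-*-Solver)
open import Data.Sum.Base as Sum using (_⊎_; inj₁; inj₂)
open import Data.Vec.Base using (Vec; []; _∷_)
open import Data.Vec.Functional using (head; tail)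
import Data.Vec.Properties as Vec
open import Function.Base using (_∘_)
open import Function.Bundles
  using (Func; Bijection; Equivalence; _⇔_; mk⇔)
open import Function.Definitions using (Injective; StrictlySurjective; Surjective)
open import Level using (0ℓ)
open import Relation.Binary.Bundles using (Setoid)
open import Relation.Binary.Construct.Closure.Transitive
  using (TransClosure; [_]; _∷_)
open import Relation.Binary.Definitions using (tri<; tri≈; tri>)
open import Relation.Binary.PropositionalEquality
  using (_≡_; _≢_; _≗_; refl; sym; trans; cong; cong₂; subst; subst₂;
         module ≡-Reasoning)
open import Relation.Nullary using (¬_; Dec; yes; no; recompute; contradiction)
open import Relation.Nullary.Decidable
  using (_→-dec_; ¬?; False; True; from-yes; map′; toWitness; toWitnessFalse)
open import Relation.Unary using (Pred; _∈_; _⊆_; _∩_; _≬_)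

-- Segments and connectedness

*-monoʳ-≤ : ∀ {r p q} → 0ℚ ℚ.≤ r → p ℚ.≤ q → r ℚ.* p ℚ.≤ r ℚ.* q
*-monoʳ-≤ {r} 0≤r = ℚ.*-monoˡ-≤-nonNeg r {{ℚ.nonNegative 0≤r}}

p≤q⇒0≤q-p : ∀ {p q} → p ℚ.≤ q → 0ℚ ℚ.≤ q ℚ.- p
p≤q⇒0≤q-p {p} {q} p≤q =
  subst (ℚ._≤ q ℚ.- p) (ℚ.+-inverseʳ p) (ℚ.+-monoˡ-≤ (ℚ.- p) p≤q)

p+[q-p]≡q : ∀ p q → p ℚ.+ (q ℚ.- p) ≡ q
p+[q-p]≡q = solve 2 (λ p q → p :+ (q :- p) := q) refl
  where open +-*-Solver

p-q≤r⇒p≤q+r : ∀ {p q r} → p ℚ.- q ℚ.≤ r → p ℚ.≤ q ℚ.+ r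
p-q≤r⇒p≤q+r {p} {q} {r} p-q≤r =
  subst (ℚ._≤ q ℚ.+ r) (p+[q-p]≡q q p) (ℚ.+-monoʳ-≤ q p-q≤r)

p≤q+r⇒p-q≤r : ∀ {p q r} → p ℚ.≤ q ℚ.+ r → p ℚ.- q ℚ.≤ r
p≤q+r⇒p-q≤r {p} {q} {r} p≤q+r =
  subst (p ℚ.- q ℚ.≤_) (cancel q r) (ℚ.+-monoˡ-≤ (ℚ.- q) p≤q+r)
  where
  open +-*-Solver
  cancel : ∀ q r → (q ℚ.+ r) ℚ.- q ≡ r
  cancel = solve 2 (λ q r → (q :+ r) :- q := r) refl

p≤∣p∣ : ∀ p → p ℚ.≤ ℚ.∣ p ∣
p≤∣p∣ p with ℚ.≤-total 0ℚ p
... | inj₁ 0≤p = ℚ.≤-reflexive (sym (ℚ.0≤p⇒∣p∣≡p 0≤p))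
... | inj₂ p≤0 = ℚ.≤-trans p≤0 (ℚ.0≤∣p∣ p)

neg-difference : ∀ p q → ℚ.- (p ℚ.- q) ≡ q ℚ.- p
neg-difference = solve 2 (λ p q → :- (p :- q) := q :- p) refl
  where open +-*-Solver

∣p-q∣-comm : ∀ p q → ℚ.∣ p ℚ.- q ∣ ≡ ℚ.∣ q ℚ.- p ∣
∣p-q∣-comm p q = trans (sym (ℚ.∣-p∣≡∣p∣ (p ℚ.- q))) (cong ℚ.∣_∣ (neg-difference p q))

∣p-q∣≤ : ∀ {p q r} → p ℚ.≤ q ℚ.+ r → q ℚ.≤ p ℚ.+ r → ℚ.∣ p ℚ.- q ∣ ℚ.≤ r
∣p-q∣≤ {p} {q} {r} p≤q+r q≤p+r with ℚ.∣p∣≡p∨∣p∣≡-p (p ℚ.- q)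
... | inj₁ eq = subst (ℚ._≤ r) (sym eq) (p≤q+r⇒p-q≤r p≤q+r)
... | inj₂ eq = subst (ℚ._≤ r) (sym (trans eq (neg-difference p q))) (p≤q+r⇒p-q≤r q≤p+r)

+-pos : ∀ {p q} → 0ℚ ℚ.< p → 0ℚ ℚ.< q → 0ℚ ℚ.< p ℚ.+ q
+-pos {p} 0<p 0<q = ℚ.<-≤-trans 0<p (p≤p+ε p 0<q)

half< : ∀ {ε} → 0ℚ ℚ.< ε → half ε ℚ.< ε
half< {ε} 0<ε = subst₂ ℚ._<_ (ℚ.+-identityʳ (half ε)) (half+half ε)
  (ℚ.+-monoʳ-< (half ε) (half-pos 0<ε))

divide : ∀ {ε B} → 0ℚ ℚ.< ε → 0ℚ ℚ.< B → ∃[ δ ] 0ℚ ℚ.< δ × δ ℚ.* B ≡ ε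
divide {ε} {B} 0<ε 0<B = ε ℚ.* 1/B , 0<δ , (begin
  (ε ℚ.* 1/B) ℚ.* B  ≡⟨ ℚ.*-assoc ε 1/B B ⟩
  ε ℚ.* (1/B ℚ.* B)  ≡⟨ cong (ε ℚ.*_) (ℚ.*-inverseˡ B) ⟩
  ε ℚ.* 1ℚ           ≡⟨ ℚ.*-identityʳ ε ⟩
  ε                  ∎)
  where
  open ≡-Reasoning
  instance
    B-pos = ℚ.positive 0<B
    B-nonZero = ℚ.pos⇒nonZero B
  1/B = ℚ.1/ B
  0<δ : 0ℚ ℚ.< ε ℚ.* 1/B
  0<δ = subst (ℚ._< ε ℚ.* 1/B) (ℚ.*-zeroˡ 1/B)
    (ℚ.*-monoˡ-<-pos 1/B {{ℚ.1/pos⇒pos B}} 0<ε)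

-- Convex combinations of rationals

opaque

  mix : ℚ → ℚ → ℚ → ℚ
  mix t a b = (1ℚ ℚ.- t) ℚ.* a ℚ.+ t ℚ.* b

  mix-const : ∀ t a → mix t a a ≡ a
  mix-const = solve 2 (λ t a → (con 1ℚ :- t) :* a :+ t :* a := a) refl
    where open +-*-Solver

  mix-zero : ∀ a b → mix 0ℚ a b ≡ a
  mix-zero = solve 2 (λ a b → (con 1ℚ :- con 0ℚ) :* a :+ con 0ℚ :* b := a) refl
    where open +-*-Solver

  mix-one : ∀ a b → mix 1ℚ a b ≡ b
  mix-one = solve 2 (λ a b → (con 1ℚ :- con 1ℚ) :* a :+ con 1ℚ :* b := b) refl
    where open +-*-Solver

  mix-+ : ∀ t a b c d → mix t (a ℚ.+ b) (c ℚ.+ d) ≡ mix t a c ℚ.+ mix t b d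
  mix-+ = solve 5 (λ t a b c d →
    (con 1ℚ :- t) :* (a :+ b) :+ t :* (c :+ d) :=
    ((con 1ℚ :- t) :* a :+ t :* c) :+ ((con 1ℚ :- t) :* b :+ t :* d)) refl
    where open +-*-Solver

  mix-shift : ∀ t a b e → mix t (a ℚ.+ e) (b ℚ.+ e) ≡ mix t a b ℚ.+ e
  mix-shift t a b e =
    trans (mix-+ t a e b e) (cong (mix t a b ℚ.+_) (mix-const t e))

  -- Splits the change of a convex combination into a part caused by the endpoints, again a convex
  -- combination, and a part caused by the parameter, so that the two can be estimated separately.
  mix-difference : ∀ s t a b c d → mix s a b ℚ.- mix t c d ≡
                   mix s (a ℚ.- c) (b ℚ.- d) ℚ.+ (s ℚ.- t) ℚ.* (d ℚ.- c)
  mix-difference = solve 6 (λ s t a b c d →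
    ((con 1ℚ :- s) :* a :+ s :* b) :- ((con 1ℚ :- t) :* c :+ t :* d) :=
    ((con 1ℚ :- s) :* (a :- c) :+ s :* (b :- d)) :+ (s :- t) :* (d :- c)) refl
    where open +-*-Solver

  mix-parameter : ∀ s t a b → mix s a b ℚ.- mix t a b ≡ (s ℚ.- t) ℚ.* (b ℚ.- a)
  mix-parameter = solve 4 (λ s t a b →
    ((con 1ℚ :- s) :* a :+ s :* b) :- ((con 1ℚ :- t) :* a :+ t :* b) :=
    (s :- t) :* (b :- a)) refl
    where open +-*-Solver

  mix-mono-≤ : ∀ {t} → 0ℚ ℚ.≤ t → t ℚ.≤ 1ℚ → ∀ {a b c d} →
               a ℚ.≤ b → c ℚ.≤ d → mix t a c ℚ.≤ mix t b d
  mix-mono-≤ {t} 0≤t t≤1 a≤b c≤d =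
    ℚ.+-mono-≤ (*-monoʳ-≤ {1ℚ ℚ.- t} (p≤q⇒0≤q-p t≤1) a≤b) (*-monoʳ-≤ {t} 0≤t c≤d)

  ∣mix∣≤ : ∀ {t} → 0ℚ ℚ.≤ t → t ℚ.≤ 1ℚ → ∀ {a b e} →
           ℚ.∣ a ∣ ℚ.≤ e → ℚ.∣ b ∣ ℚ.≤ e → ℚ.∣ mix t a b ∣ ℚ.≤ e
  ∣mix∣≤ {t} 0≤t t≤1 {a} {b} {e} ∣a∣≤e ∣b∣≤e = begin
    ℚ.∣ mix t a b ∣
      ≤⟨ ℚ.∣p+q∣≤∣p∣+∣q∣ ((1ℚ ℚ.- t) ℚ.* a) (t ℚ.* b) ⟩
    ℚ.∣ (1ℚ ℚ.- t) ℚ.* a ∣ ℚ.+ ℚ.∣ t ℚ.* b ∣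
      ≡⟨ cong₂ ℚ._+_ (scale {1ℚ ℚ.- t} (p≤q⇒0≤q-p t≤1) a) (scale 0≤t b) ⟩
    mix t ℚ.∣ a ∣ ℚ.∣ b ∣
      ≤⟨ mix-mono-≤ 0≤t t≤1 ∣a∣≤e ∣b∣≤e ⟩
    mix t e e
      ≡⟨ mix-const t e ⟩
    e ∎
    where
    open ℚ.≤-Reasoning
    scale : ∀ {r} → 0ℚ ℚ.≤ r → ∀ p → ℚ.∣ r ℚ.* p ∣ ≡ r ℚ.* ℚ.∣ p ∣
    scale {r} 0≤r p =
      trans (ℚ.∣p*q∣≡∣p∣*∣q∣ r p) (cong (ℚ._* ℚ.∣ p ∣) (ℚ.0≤p⇒∣p∣≡p 0≤r))

-- Bounds on reals and on the length of a segment

Bounded : ℚ → ℝ → Set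
Bounded B x = Eventually (λ n → ℚ.∣ seq x n ∣ ℚ.≤ B)

bounded : ∀ x → ∃[ B ] 0ℚ ℚ.< B × Bounded B x
bounded x with cauchy x 1ℚ (ℚ.positive⁻¹ 1ℚ)
... | N , p = ℚ.∣ a ∣ ℚ.+ 1ℚ
            , ℚ.<-≤-trans (ℚ.positive⁻¹ 1ℚ)
                (subst (ℚ._≤ ℚ.∣ a ∣ ℚ.+ 1ℚ) (ℚ.+-identityˡ 1ℚ)
                  (ℚ.+-monoˡ-≤ 1ℚ (ℚ.0≤∣p∣ a)))
            , N , λ n N≤n → begin
  ℚ.∣ seq x n ∣
    ≡⟨ cong ℚ.∣_∣ (sym (p+[q-p]≡q a (seq x n))) ⟩
  ℚ.∣ a ℚ.+ (seq x n ℚ.- a) ∣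
    ≤⟨ ℚ.∣p+q∣≤∣p∣+∣q∣ a (seq x n ℚ.- a) ⟩
  ℚ.∣ a ∣ ℚ.+ ℚ.∣ seq x n ℚ.- a ∣
    ≤⟨ ℚ.+-monoʳ-≤ ℚ.∣ a ∣ (ℚ.<⇒≤ (p n N N≤n ℕ.≤-refl)) ⟩
  ℚ.∣ a ∣ ℚ.+ 1ℚ ∎
  where
  open ℚ.≤-Reasoning
  a = seq x N

-- Serves two purposes: with a large bound it controls the length of a segment, with a small one it
-- says that two parameters are close.
Separated : ℚ → ℝ → ℝ → Set
Separated B x y = Eventually (λ n → ℚ.∣ seq y n ℚ.- seq x n ∣ ℚ.≤ B)

separated : ∀ x y → ∃[ B ] 0ℚ ℚ.< B × Separated B x y
separated x y =
  let B , 0<B , x-bounded = bounded x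
      C , 0<C , y-bounded = bounded y
  in C ℚ.+ B , +-pos 0<C 0<B , eventually₂ (bound B C) x-bounded y-bounded
  where
  bound : ∀ B C n → ℚ.∣ seq x n ∣ ℚ.≤ B → ℚ.∣ seq y n ∣ ℚ.≤ C →
          ℚ.∣ seq y n ℚ.- seq x n ∣ ℚ.≤ C ℚ.+ B
  bound B C n ∣x∣≤B ∣y∣≤C =
    ℚ.≤-trans (ℚ.∣p-q∣≤∣p∣+∣q∣ (seq y n) (seq x n)) (ℚ.+-mono-≤ ∣y∣≤C ∣x∣≤B)

separated-weaken : ∀ {B C} → B ℚ.≤ C → ∀ x y → Separated B x y → Separated C x y
separated-weaken B≤C x y (N , p) = N , λ n N≤n → ℚ.≤-trans (p n N≤n) B≤C

separated-all : ∀ {m} (z w : Point m) →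
                ∃[ B ] 0ℚ ℚ.< B × (∀ i → Separated B (z i) (w i))
separated-all {zero}  z w = 1ℚ , ℚ.positive⁻¹ 1ℚ , λ ()
separated-all {suc m} z w =
  let B , 0<B , head-sep = separated (head z) (head w)
      C , 0<C , tail-sep = separated-all (tail z) (tail w)
  -- The sum of the bounds serves as a common bound in place of their maximum.
  in B ℚ.+ C , +-pos 0<B 0<C , λ
    { zero    → separated-weaken (p≤p+ε B 0<C) (head z) (head w) head-sep
    ; (suc i) → separated-weaken
        (subst (C ℚ.≤_) (ℚ.+-comm C B) (p≤p+ε C 0<B)) (tail z i) (tail w i) (tail-sep i)
    }

-- The bounds hold for every rational approximation, not only in the limit, so the estimates for
-- `mix` apply termwise at every index.
record UnitInterval : Set where
  field
    real : ℝ
    0≤   : ∀ n → 0ℚ ℚ.≤ seq real n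
    ≤1   : ∀ n → seq real n ℚ.≤ 1ℚ

open UnitInterval public

-- One half of `ε` pays for the movement of the endpoints, the other half for the movement of the
-- parameter along a segment of length at most `B`.
mix-close : ∀ {ε δ B} → 0ℚ ℚ.< B → δ ℚ.* B ≡ half ε →
  ∀ σ τ a b c d → 0ℚ ℚ.≤ σ → σ ℚ.≤ 1ℚ →
  ℚ.∣ σ ℚ.- τ ∣ ℚ.< δ → ℚ.∣ a ℚ.- c ∣ ℚ.< half ε → ℚ.∣ b ℚ.- d ∣ ℚ.< half ε →
  ℚ.∣ d ℚ.- c ∣ ℚ.≤ B → ℚ.∣ mix σ a b ℚ.- mix τ c d ∣ ℚ.< ε
mix-close {ε} {δ} {B} 0<B δB≡ σ τ a b c d 0≤σ σ≤1 σ-τ a-c b-d d-c = begin-strict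
  ℚ.∣ mix σ a b ℚ.- mix τ c d ∣
    ≡⟨ cong ℚ.∣_∣ (mix-difference σ τ a b c d) ⟩
  ℚ.∣ mix σ (a ℚ.- c) (b ℚ.- d) ℚ.+ (σ ℚ.- τ) ℚ.* (d ℚ.- c) ∣
    ≤⟨ ℚ.∣p+q∣≤∣p∣+∣q∣ (mix σ (a ℚ.- c) (b ℚ.- d)) ((σ ℚ.- τ) ℚ.* (d ℚ.- c)) ⟩
  ℚ.∣ mix σ (a ℚ.- c) (b ℚ.- d) ∣ ℚ.+ ℚ.∣ (σ ℚ.- τ) ℚ.* (d ℚ.- c) ∣
    ≤⟨ ℚ.+-monoˡ-≤ ℚ.∣ (σ ℚ.- τ) ℚ.* (d ℚ.- c) ∣
         (∣mix∣≤ 0≤σ σ≤1 (ℚ.<⇒≤ a-c) (ℚ.<⇒≤ b-d)) ⟩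
  half ε ℚ.+ ℚ.∣ (σ ℚ.- τ) ℚ.* (d ℚ.- c) ∣
    ≡⟨ cong (half ε ℚ.+_) (ℚ.∣p*q∣≡∣p∣*∣q∣ (σ ℚ.- τ) (d ℚ.- c)) ⟩
  half ε ℚ.+ ℚ.∣ σ ℚ.- τ ∣ ℚ.* ℚ.∣ d ℚ.- c ∣
    ≤⟨ ℚ.+-monoʳ-≤ (half ε) (*-monoʳ-≤ (ℚ.0≤∣p∣ (σ ℚ.- τ)) d-c) ⟩
  half ε ℚ.+ ℚ.∣ σ ℚ.- τ ∣ ℚ.* B
    <⟨ ℚ.+-monoʳ-< (half ε) (ℚ.*-monoˡ-<-pos B {{ℚ.positive 0<B}} σ-τ) ⟩
  half ε ℚ.+ δ ℚ.* B
    ≡⟨ trans (cong (half ε ℚ.+_) δB≡) (half+half ε) ⟩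
  ε ∎
  where open ℚ.≤-Reasoning

-- Opaque, because comparing two real numbers compares their moduli.
opaque

  lerp-cauchy : ∀ t x y ε → 0ℚ ℚ.< ε → ∃[ N ] ∀ i j → N ℕ.≤ i → N ℕ.≤ j →
    ℚ.∣ mix (seq (real t) i) (seq x i) (seq y i) ℚ.-
        mix (seq (real t) j) (seq x j) (seq y j) ∣ ℚ.< ε
  lerp-cauchy t x y ε 0<ε =
    let B , 0<B , S , sep = separated x y
        δ , 0<δ , δB≡     = divide (half-pos 0<ε) 0<B
        K , t-cauchy      = cauchy (real t) δ 0<δ
        M , x-cauchy      = cauchy x (half ε) (half-pos 0<ε)
        N , y-cauchy      = cauchy y (half ε) (half-pos 0<ε)
    in (S ℕ.⊔ K) ℕ.⊔ (M ℕ.⊔ N) , λ i j i≥ j≥ →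
      let S⊔K≤i = ℕ.m⊔n≤o⇒m≤o (S ℕ.⊔ K) (M ℕ.⊔ N) i≥
          M⊔N≤i = ℕ.m⊔n≤o⇒n≤o (S ℕ.⊔ K) (M ℕ.⊔ N) i≥
          S⊔K≤j = ℕ.m⊔n≤o⇒m≤o (S ℕ.⊔ K) (M ℕ.⊔ N) j≥
          M⊔N≤j = ℕ.m⊔n≤o⇒n≤o (S ℕ.⊔ K) (M ℕ.⊔ N) j≥
      in mix-close 0<B δB≡ (seq (real t) i) (seq (real t) j)
           (seq x i) (seq y i) (seq x j) (seq y j) (0≤ t i) (≤1 t i)
           (t-cauchy i j (ℕ.m⊔n≤o⇒n≤o S K S⊔K≤i) (ℕ.m⊔n≤o⇒n≤o S K S⊔K≤j))
           (x-cauchy i j (ℕ.m⊔n≤o⇒m≤o M N M⊔N≤i) (ℕ.m⊔n≤o⇒m≤o M N M⊔N≤j))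
           (y-cauchy i j (ℕ.m⊔n≤o⇒n≤o M N M⊔N≤i) (ℕ.m⊔n≤o⇒n≤o M N M⊔N≤j))
           -- The segment length that enters `mix-difference` is the one at index `j`.
           (sep j (ℕ.m⊔n≤o⇒m≤o S K S⊔K≤j))

lerp : UnitInterval → ℝ → ℝ → ℝ
lerp t x y .seq n  = mix (seq (real t) n) (seq x n) (seq y n)
lerp t x y .cauchy = lerp-cauchy t x y

constant : ∀ {q} → 0ℚ ℚ.≤ q → q ℚ.≤ 1ℚ → UnitInterval
constant {q} 0≤q q≤1 = record { real = fromℚ q ; 0≤ = λ _ → 0≤q ; ≤1 = λ _ → q≤1 }

lerpᵖ : ∀ {m} → UnitInterval → Point m → Point m → Point m
lerpᵖ t z w i = lerp t (z i) (w i)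

-- Moving the parameter by `δ` moves the point by at most `δ ℚ.* B`, that is `half ε`; the remaining
-- half is the gap of the strict inequality.
lerp-close : ∀ {ε δ B} → 0ℚ ℚ.< ε → δ ℚ.* B ≡ half ε →
             ∀ (s t : UnitInterval) → Separated δ (real t) (real s) →
             ∀ x y → Separated B x y → lerp s x y < lerp t x y + fromℚ ε
lerp-close {ε} {δ} {B} 0<ε δB≡ s t near x y sep =
  half ε , half-pos 0<ε , eventually₂ bound near sep
  where
  open ℚ.≤-Reasoning
  difference≤ : ∀ {σ τ a b} → ℚ.∣ σ ℚ.- τ ∣ ℚ.≤ δ → ℚ.∣ b ℚ.- a ∣ ℚ.≤ B →
                mix σ a b ℚ.- mix τ a b ℚ.≤ half ε
  difference≤ {σ} {τ} {a} {b} near sep = begin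
    mix σ a b ℚ.- mix τ a b
      ≤⟨ p≤∣p∣ (mix σ a b ℚ.- mix τ a b) ⟩
    ℚ.∣ mix σ a b ℚ.- mix τ a b ∣
      ≡⟨ trans (cong ℚ.∣_∣ (mix-parameter σ τ a b))
               (ℚ.∣p*q∣≡∣p∣*∣q∣ (σ ℚ.- τ) (b ℚ.- a)) ⟩
    ℚ.∣ σ ℚ.- τ ∣ ℚ.* ℚ.∣ b ℚ.- a ∣
      ≤⟨ *-monoʳ-≤ (ℚ.0≤∣p∣ (σ ℚ.- τ)) sep ⟩
    ℚ.∣ σ ℚ.- τ ∣ ℚ.* B
      ≤⟨ ℚ.*-monoʳ-≤-nonNeg B
           {{ℚ.nonNegative (ℚ.≤-trans (ℚ.0≤∣p∣ (b ℚ.- a)) sep)}} near ⟩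
    δ ℚ.* B
      ≡⟨ δB≡ ⟩
    half ε ∎
  bound : ∀ n → ℚ.∣ seq (real s) n ℚ.- seq (real t) n ∣ ℚ.≤ δ →
          ℚ.∣ seq y n ℚ.- seq x n ∣ ℚ.≤ B →
          seq (lerp s x y) n ℚ.+ half ε ℚ.≤ seq (lerp t x y) n ℚ.+ ε
  bound n near sep = begin
    seq (lerp s x y) n ℚ.+ half ε
      ≤⟨ ℚ.+-monoˡ-≤ (half ε)
           (p-q≤r⇒p≤q+r {seq (lerp s x y) n} {seq (lerp t x y) n}
             (difference≤ {seq (real s) n} {seq (real t) n} near sep)) ⟩
    (seq (lerp t x y) n ℚ.+ half ε) ℚ.+ half ε
      ≡⟨ ℚ.+-assoc (seq (lerp t x y) n) (half ε) (half ε) ⟩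
    seq (lerp t x y) n ℚ.+ (half ε ℚ.+ half ε)
      ≡⟨ cong (seq (lerp t x y) n ℚ.+_) (half+half ε) ⟩
    seq (lerp t x y) n ℚ.+ ε ∎

separated-sym : ∀ {B x y} → Separated B x y → Separated B y x
separated-sym {B} {x} {y} (N , p) = N , λ n N≤n →
  subst (ℚ._≤ B) (∣p-q∣-comm (seq y n) (seq x n)) (p n N≤n)

-- Membership in an open set persists under small changes of the parameter: the bound `B` is common
-- to all coordinates, so a single `δ` keeps every coordinate within the ball.
open-∋-close : ∀ {m} {A : Pred (Point m) 0ℓ} → Open A → ∀ {t z w} → lerpᵖ t z w ∈ A →
  ∃[ δ ] 0ℚ ℚ.< δ × (∀ s → Separated δ (real t) (real s) → lerpᵖ s z w ∈ A)
open-∋-close open-A {t} {z} {w} t∈A =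
  let ε , 0<ε , ball = open-A t∈A
      B , 0<B , sep  = separated-all z w
      δ , 0<δ , δB≡  = divide (half-pos 0<ε) 0<B
  in δ , 0<δ , λ s near → ball (lerpᵖ s z w) λ i →
    lerp-close 0<ε δB≡ s t near (z i) (w i) (sep i) ,
    lerp-close 0<ε δB≡ t s (separated-sym {x = real t} {real s} near)
      (z i) (w i) (sep i)

-- Points with the same approximations may carry different moduli and so be unequal as terms, but
-- each lies in every ball around the other.
open-resp-≗ : ∀ {m} {A : Pred (Point m) 0ℓ} → Open A → ∀ {z w} →
              (∀ i → seq (z i) ≗ seq (w i)) → z ∈ A → w ∈ A
open-resp-≗ open-A {z} {w} z≗w z∈A with open-A z∈A
... | ε , 0<ε , ball = ball w λ i →
  (ε , 0<ε , 0 , λ n _ → ℚ.≤-reflexive (cong (ℚ._+ ε) (sym (z≗w i n)))) ,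
  (ε , 0<ε , 0 , λ n _ → ℚ.≤-reflexive (cong (ℚ._+ ε) (z≗w i n)))

-- The power of one half with exponent `n`, which is the length of the bracket after `n` bisections.
width : ℕ → ℚ
width = fold 1ℚ half

width-pos : ∀ n → 0ℚ ℚ.< width n
width-pos zero    = ℚ.positive⁻¹ 1ℚ
width-pos (suc n) = half-pos (width-pos n)

width≤1 : ∀ n → width n ℚ.≤ 1ℚ
width≤1 zero    = ℚ.≤-refl
width≤1 (suc n) = ℚ.≤-trans (half≤ (width-pos n)) (width≤1 n)

fromℕ : ℕ → ℚ
fromℕ = fold 0ℚ (1ℚ ℚ.+_)

-- `mkℚᵘ` takes the denominator minus one, so its `0` stands for denominator one.
toℚᵘ-fromℕ : ∀ n → ℚ.toℚᵘ (fromℕ n) ℚᵘ.≃ mkℚᵘ (ℤ.+ n) 0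
toℚᵘ-fromℕ zero    = ℚᵘ.*≡* refl
toℚᵘ-fromℕ (suc n) = begin
  ℚ.toℚᵘ (1ℚ ℚ.+ fromℕ n)
    ≈⟨ ℚ.toℚᵘ-homo-+ 1ℚ (fromℕ n) ⟩
  ℚ.toℚᵘ 1ℚ ℚᵘ.+ ℚ.toℚᵘ (fromℕ n)
    ≈⟨ ℚᵘ.+-congʳ (ℚ.toℚᵘ 1ℚ) (toℚᵘ-fromℕ n) ⟩
  ℚ.toℚᵘ 1ℚ ℚᵘ.+ mkℚᵘ (ℤ.+ n) 0
    ≈⟨ ℚᵘ.*≡* (cong (λ k → (ℤ.1ℤ ℤ.+ k) ℤ.* ℤ.1ℤ) (ℤ.*-identityʳ (ℤ.+ n))) ⟩
  mkℚᵘ (ℤ.+ suc n) 0 ∎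
  where open ℚᵘ.≃-Reasoning

-- A fraction is at most the absolute value of its numerator, because its denominator is at least
-- one.
archimedean : ∀ q → ∃[ n ] q ℚ.≤ fromℕ n
archimedean q@(mkℚ i d _) = ℤ.∣ i ∣ , ℚ.toℚᵘ-cancel-≤
  (ℚᵘ.≤-respʳ-≃ (ℚᵘ.≃-sym (toℚᵘ-fromℕ ℤ.∣ i ∣)) (ℚᵘ.*≤* (begin
    i ℤ.* ℤ.1ℤ               ≡⟨ ℤ.*-identityʳ i ⟩
    i                        ≤⟨ i≤∣i∣ i ⟩
    ℤ.+ ℤ.∣ i ∣              ≤⟨ ℤ.+≤+ (ℕ.m≤m*n ℤ.∣ i ∣ (suc d)) ⟩
    ℤ.+ (ℤ.∣ i ∣ ℕ.* suc d)  ≡⟨ ℤ.pos-* ℤ.∣ i ∣ (suc d) ⟩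
    ℤ.+ ℤ.∣ i ∣ ℤ.* ℤ.+ suc d ∎)))
  where
  open ℤ.≤-Reasoning
  i≤∣i∣ : ∀ i → i ℤ.≤ ℤ.+ ℤ.∣ i ∣
  i≤∣i∣ (ℤ.+ n)    = ℤ.≤-refl
  i≤∣i∣ ℤ.-[1+ n ] = ℤ.-≤+

p+p≤q+q⇒p≤q : ∀ {p q} → p ℚ.+ p ℚ.≤ q ℚ.+ q → p ℚ.≤ q
p+p≤q+q⇒p≤q p+p≤q+q = ℚ.≮⇒≥ λ q<p →
  ℚ.<-irrefl refl (ℚ.<-≤-trans (ℚ.+-mono-< q<p q<p) p+p≤q+q)

-- A division-free form of the bound of `n` by the `n`-th power of two. In the induction both sides
-- are doubled, so that the halves recombine into `width n` and each of the two summands is at most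
-- one.
width*fromℕ≤1 : ∀ n → width n ℚ.* fromℕ n ℚ.≤ 1ℚ
width*fromℕ≤1 zero    =
  ℚ.≤-trans (ℚ.≤-reflexive (ℚ.*-zeroʳ 1ℚ)) (ℚ.<⇒≤ (ℚ.positive⁻¹ 1ℚ))
width*fromℕ≤1 (suc n) = p+p≤q+q⇒p≤q {h ℚ.* (1ℚ ℚ.+ fromℕ n)} {1ℚ} (begin
  h ℚ.* (1ℚ ℚ.+ fromℕ n) ℚ.+ h ℚ.* (1ℚ ℚ.+ fromℕ n)
    ≡⟨ expand h (fromℕ n) ⟩
  (h ℚ.+ h) ℚ.+ (h ℚ.+ h) ℚ.* fromℕ n
    ≡⟨ cong (λ w → w ℚ.+ w ℚ.* fromℕ n) (half+half (width n)) ⟩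
  width n ℚ.+ width n ℚ.* fromℕ n
    ≤⟨ ℚ.+-mono-≤ (width≤1 n) (width*fromℕ≤1 n) ⟩
  1ℚ ℚ.+ 1ℚ ∎)
  where
  open ℚ.≤-Reasoning
  open +-*-Solver
  h = half (width n)
  expand : ∀ h n → h ℚ.* (1ℚ ℚ.+ n) ℚ.+ h ℚ.* (1ℚ ℚ.+ n) ≡
                   (h ℚ.+ h) ℚ.+ (h ℚ.+ h) ℚ.* n
  expand = solve 2 (λ h n → h :* (con 1ℚ :+ n) :+ h :* (con 1ℚ :+ n) :=
                            (h :+ h) :+ (h :+ h) :* n) refl

width-small : ∀ {δ} → 0ℚ ℚ.< δ → ∃[ n ] width n ℚ.≤ δ
width-small {δ} 0<δ =
  -- Here `q` is the inverse of `δ`, and any natural number above it is large enough.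
  let q , 0<q , qδ≡1 = divide (ℚ.positive⁻¹ 1ℚ) 0<δ
      n , q≤n        = archimedean q
      0<n            = ℚ.<-≤-trans 0<q q≤n
  in n , ℚ.*-cancelʳ-≤-pos (fromℕ n) {{ℚ.positive 0<n}} (begin
    width n ℚ.* fromℕ n  ≤⟨ width*fromℕ≤1 n ⟩
    1ℚ                   ≡⟨ sym qδ≡1 ⟩
    q ℚ.* δ              ≡⟨ ℚ.*-comm q δ ⟩
    δ ℚ.* q              ≤⟨ *-monoʳ-≤ (ℚ.<⇒≤ 0<δ) q≤n ⟩
    δ ℚ.* fromℕ n        ∎)
  where open ℚ.≤-Reasoning

-- A constructive form of the supremum argument: `cover` settles each midpoint, the left end stays
-- in `P` and the right end in `Q`, and the brackets shrink to a single parameter. A point may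
-- satisfy both predicates.
module Bisection
  (P Q : Pred ℚ 0ℓ)
  (P⇒0≤ : ∀ {q} → P q → 0ℚ ℚ.≤ q) (Q⇒≤1 : ∀ {q} → Q q → q ℚ.≤ 1ℚ)
  (P-zero : P 0ℚ) (Q-one : Q 1ℚ)
  (cover : ∀ {q} → 0ℚ ℚ.≤ q → q ℚ.≤ 1ℚ → P q ⊎ Q q)
  where

  record Bracket (w : ℚ) : Set where
    field
      left : ℚ
      P-left  : P left
      Q-right : Q (left ℚ.+ w)

  open Bracket

  bisect : ∀ {w} → 0ℚ ℚ.< w → (b : Bracket w) → Σ (Bracket (half w)) λ b′ →
           left b ℚ.≤ left b′ × left b′ ℚ.+ half w ℚ.≤ left b ℚ.+ w
  bisect {w} 0<w b
    with cover {left b ℚ.+ half w}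
           (ℚ.≤-trans (P⇒0≤ (P-left b)) (p≤p+ε (left b) (half-pos 0<w)))
           (ℚ.≤-trans (ℚ.+-monoʳ-≤ (left b) (half≤ 0<w)) (Q⇒≤1 (Q-right b)))
  ... | inj₁ p = record { left = left b ℚ.+ half w ; P-left = p
                        ; Q-right = subst Q (sym halves) (Q-right b) }
               , p≤p+ε (left b) (half-pos 0<w) , ℚ.≤-reflexive halves
    where
    halves : (left b ℚ.+ half w) ℚ.+ half w ≡ left b ℚ.+ w
    halves = trans (ℚ.+-assoc (left b) (half w) (half w))
                   (cong (left b ℚ.+_) (half+half w))
  ... | inj₂ q = record { left = left b ; P-left = P-left b ; Q-right = q }
               , ℚ.≤-refl , ℚ.+-monoʳ-≤ (left b) (half≤ 0<w)

  bracket : ∀ n → Bracket (width n)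
  bracket zero    = record { left = 0ℚ ; P-left = P-zero
                           ; Q-right = subst Q (sym (ℚ.+-identityˡ 1ℚ)) Q-one }
  bracket (suc n) = proj₁ (bisect (width-pos n) (bracket n))

  lower upper : ℕ → ℚ
  lower n = left (bracket n)
  upper n = lower n ℚ.+ width n

  lower-mono : ∀ {m n} → m ℕ.≤′ n → lower m ℚ.≤ lower n
  lower-mono ℕ.≤′-refl = ℚ.≤-refl
  lower-mono {n = suc n} (ℕ.≤′-step m≤n) = ℚ.≤-trans (lower-mono m≤n)
    (proj₁ (proj₂ (bisect (width-pos n) (bracket n))))

  upper-anti : ∀ {m n} → m ℕ.≤′ n → upper n ℚ.≤ upper m
  upper-anti ℕ.≤′-refl = ℚ.≤-refl
  upper-anti {n = suc n} (ℕ.≤′-step m≤n) = ℚ.≤-trans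
    (proj₂ (proj₂ (bisect (width-pos n) (bracket n)))) (upper-anti m≤n)

  lower≤upper : ∀ n → lower n ℚ.≤ upper n
  lower≤upper n = p≤p+ε (lower n) (width-pos n)

  module _ {m n} (m≤n : m ℕ.≤ n) where

    lower≤ : lower m ℚ.≤ lower n
    lower≤ = lower-mono (ℕ.≤⇒≤′ m≤n)

    ≤upper : lower n ℚ.≤ upper m
    ≤upper = ℚ.≤-trans (lower≤upper n) (upper-anti (ℕ.≤⇒≤′ m≤n))

  limit : UnitInterval
  limit .real .seq = lower
  limit .real .cauchy ε 0<ε =
    let N , small = width-small (half-pos 0<ε)
        -- From `N` on all lower ends lie in the bracket reached at `N`, whose width is at most
        -- `half ε`.
        within : ∀ {i j} → N ℕ.≤ i → N ℕ.≤ j → lower i ℚ.≤ lower j ℚ.+ half ε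
        within N≤i N≤j =
          ℚ.≤-trans (≤upper N≤i) (ℚ.+-mono-≤ (lower≤ N≤j) small)
    in N , λ i j N≤i N≤j → ℚ.≤-<-trans
      (∣p-q∣≤ (within N≤i N≤j) (within N≤j N≤i)) (half< 0<ε)
  limit .0≤ n = P⇒0≤ (P-left (bracket n))
  limit .≤1 n = ℚ.≤-trans (lower≤upper n) (Q⇒≤1 (Q-right (bracket n)))

  -- The two ends of one sufficiently narrow bracket, which contains all later lower ends. Both are
  -- provided because it is not known in advance which open set will contain the limit.
  near-limit : ∀ {δ} → 0ℚ ℚ.< δ → ∃₂ λ p q → P p × Q q ×
    Separated δ (real limit) (fromℚ p) × Separated δ (real limit) (fromℚ q)
  near-limit {δ} 0<δ =
    let N , small = width-small 0<δ
    in lower N , upper N , P-left (bracket N) , Q-right (bracket N) ,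
      (N , λ n N≤n → ∣p-q∣≤
        (ℚ.≤-trans (lower≤ N≤n) (p≤p+ε (lower n) 0<δ))
        (ℚ.≤-trans (≤upper N≤n) (ℚ.+-monoʳ-≤ (lower N) small))) ,
      (N , λ n N≤n → ∣p-q∣≤
        (ℚ.+-mono-≤ (lower≤ N≤n) small)
        (ℚ.≤-trans (≤upper N≤n) (p≤p+ε (upper N) 0<δ)))

-- Convex sets are connected

Convex : ∀ {m} → Pred (Point m) 0ℓ → Set
Convex C = ∀ {z w} → z ∈ C → w ∈ C → ∀ t → lerpᵖ t z w ∈ C

-- Bisecting the segment from a point of `A` to a point of `B` yields a limit that the cover puts
-- into one of the two sets. By openness that set also contains a nearby bracket end lying in the
-- other one.
convex⇒connected : ∀ {m} {C : Pred (Point m) 0ℓ} → Convex C → Connected C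
convex⇒connected {m} {C} convex A B open-A open-B C⊆A∪B
  (z , z∈C , z∈A) (w , w∈C , w∈B) = meet (C⊆A∪B (convex z∈C w∈C limit))
  where
  0≤1 : 0ℚ ℚ.≤ 1ℚ
  0≤1 = ℚ.<⇒≤ (ℚ.positive⁻¹ 1ℚ)

  segment : ∀ {q} → 0ℚ ℚ.≤ q → q ℚ.≤ 1ℚ → Point m
  segment 0≤q q≤1 = lerpᵖ (constant 0≤q q≤1) z w

  On : Pred (Point m) 0ℓ → Pred ℚ 0ℓ
  -- The bounds are stored because `segment` takes them as arguments.
  On X q = Σ (0ℚ ℚ.≤ q) λ 0≤q → Σ (q ℚ.≤ 1ℚ) λ q≤1 → segment 0≤q q≤1 ∈ X

  start : On A 0ℚ
  start = ℚ.≤-refl , 0≤1 ,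
    open-resp-≗ open-A {z} {segment ℚ.≤-refl 0≤1}
      (λ i n → sym (mix-zero (seq (z i) n) (seq (w i) n))) z∈A

  end : On B 1ℚ
  end = 0≤1 , ℚ.≤-refl ,
    open-resp-≗ open-B {w} {segment 0≤1 ℚ.≤-refl}
      (λ i n → sym (mix-one (seq (z i) n) (seq (w i) n))) w∈B

  cover : ∀ {q} → 0ℚ ℚ.≤ q → q ℚ.≤ 1ℚ → On A q ⊎ On B q
  cover 0≤q q≤1 = Sum.map (λ ∈A → 0≤q , q≤1 , ∈A) (λ ∈B → 0≤q , q≤1 , ∈B)
    (C⊆A∪B (convex z∈C w∈C (constant 0≤q q≤1)))

  open Bisection (On A) (On B) proj₁ (λ b → proj₁ (proj₂ b)) start end cover

  meet : lerpᵖ limit z w ∈ A ⊎ lerpᵖ limit z w ∈ B → C ≬ (A ∩ B)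
  meet (inj₁ ∈A) =
    let δ , 0<δ , close = open-∋-close open-A {limit} {z} {w} ∈A
        p , q , _ , (0≤q , q≤1 , ∈B) , _ , near = near-limit 0<δ
    in segment 0≤q q≤1 , convex z∈C w∈C (constant 0≤q q≤1) ,
       close (constant 0≤q q≤1) near , ∈B
  meet (inj₂ ∈B) =
    let δ , 0<δ , close = open-∋-close open-B {limit} {z} {w} ∈B
        p , q , (0≤p , p≤1 , ∈A) , _ , near , _ = near-limit 0<δ
    in segment 0≤p p≤1 , convex z∈C w∈C (constant 0≤p p≤1) ,
       ∈A , close (constant 0≤p p≤1) near

-- Cells of the arrangement

<-resp-≗ : ∀ {a b x y} → seq a ≗ seq x → seq b ≗ seq y → x < y → a < b
<-resp-≗ a≗x b≗y (ε , 0<ε , N , p) = ε , 0<ε , N , λ n N≤n →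
  subst₂ (λ r s → r ℚ.+ ε ℚ.≤ s) (sym (a≗x n)) (sym (b≗y n)) (p n N≤n)

≤-resp-≗ : ∀ {a b x y} → seq a ≗ seq x → seq b ≗ seq y → x ≤ y → a ≤ b
≤-resp-≗ a≗x b≗y x≤y ε 0<ε = let N , p = x≤y ε 0<ε in N , λ n N≤n →
  subst₂ (λ r s → r ℚ.≤ s ℚ.+ ε) (sym (a≗x n)) (sym (b≗y n)) (p n N≤n)

lerp-mono-≤ : ∀ t {x y u v} → x ≤ y → u ≤ v → lerp t x u ≤ lerp t y v
lerp-mono-≤ t {x} {y} {u} {v} x≤y u≤v ε 0<ε =
  eventually₂ bound (x≤y ε 0<ε) (u≤v ε 0<ε)
  where
  bound : ∀ n → seq x n ℚ.≤ seq y n ℚ.+ ε → seq u n ℚ.≤ seq v n ℚ.+ ε →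
          seq (lerp t x u) n ℚ.≤ seq (lerp t y v) n ℚ.+ ε
  bound n p q = subst (seq (lerp t x u) n ℚ.≤_)
    (mix-shift (seq (real t) n) (seq y n) (seq v n) ε)
    (mix-mono-≤ (0≤ t n) (≤1 t n) p q)

common-margin : ∀ {ε δ} → 0ℚ ℚ.< ε → 0ℚ ℚ.< δ →
                ∃[ η ] 0ℚ ℚ.< η × η ℚ.≤ ε × η ℚ.≤ δ
common-margin {ε} {δ} 0<ε 0<δ with ℚ.≤-total ε δ
... | inj₁ ε≤δ = ε , 0<ε , ℚ.≤-refl , ε≤δ
... | inj₂ δ≤ε = δ , 0<δ , δ≤ε , ℚ.≤-refl

-- The parameter may come arbitrarily close to either end, so the gap kept is the smaller of the
-- two, which survives at every parameter.
lerp-mono-< : ∀ t {x y u v} → x < y → u < v → lerp t x u < lerp t y v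
lerp-mono-< t {x} {y} {u} {v} (ε , 0<ε , x<y) (δ , 0<δ , u<v) =
  let η , 0<η , η≤ε , η≤δ = common-margin 0<ε 0<δ
  in η , 0<η , eventually₂ (bound η≤ε η≤δ) x<y u<v
  where
  bound : ∀ {η} → η ℚ.≤ ε → η ℚ.≤ δ → ∀ n →
          seq x n ℚ.+ ε ℚ.≤ seq y n → seq u n ℚ.+ δ ℚ.≤ seq v n →
          seq (lerp t x u) n ℚ.+ η ℚ.≤ seq (lerp t y v) n
  bound {η} η≤ε η≤δ n p q = subst (ℚ._≤ seq (lerp t y v) n)
    (mix-shift (seq (real t) n) (seq x n) (seq u n) η)
    (mix-mono-≤ (0≤ t n) (≤1 t n)
      (ℚ.≤-trans (ℚ.+-monoʳ-≤ (seq x n) η≤ε) p)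
      (ℚ.≤-trans (ℚ.+-monoʳ-≤ (seq u n) η≤δ) q))

∑-lerp : ∀ {m} (S : Subset m) t (z w : Point m) →
         seq (∑[ S ] (lerpᵖ t z w)) ≗ seq (lerp t (∑[ S ] z) (∑[ S ] w))
∑-lerp []            t z w n = sym (mix-const (seq (real t) n) 0ℚ)
∑-lerp (inside  ∷ S) t z w n = begin
  seq (lerp t (head z) (head w)) n ℚ.+ seq (∑[ S ] (lerpᵖ t (tail z) (tail w))) n
    ≡⟨ cong (seq (lerp t (head z) (head w)) n ℚ.+_) (∑-lerp S t (tail z) (tail w) n) ⟩
  seq (lerp t (head z) (head w)) n ℚ.+ seq (lerp t (∑[ S ] (tail z)) (∑[ S ] (tail w))) n
    ≡⟨ sym (mix-+ (seq (real t) n) (seq (head z) n) (seq (∑[ S ] (tail z)) n)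
                               (seq (head w) n) (seq (∑[ S ] (tail w)) n)) ⟩
  seq (lerp t (∑[ inside ∷ S ] z) (∑[ inside ∷ S ] w)) n ∎
  where open ≡-Reasoning
∑-lerp (outside ∷ S) t z w n = ∑-lerp S t (tail z) (tail w) n

simplex-convex : ∀ m → Convex (Simplex m)
simplex-convex m {z} {w} (z≥0 , z≤1 , z≥1) (w≥0 , w≤1 , w≥1) t =
  (λ i → ≤-resp-≗ {0ℝ} {lerp t (z i) (w i)} {lerp t 0ℝ 0ℝ} {lerp t (z i) (w i)}
    (λ n → sym (mix-const (seq (real t) n) 0ℚ)) (λ _ → refl)
    (lerp-mono-≤ t {0ℝ} {z i} {0ℝ} {w i} (z≥0 i) (w≥0 i))) ,
  ≤-resp-≗ {∑[ ⊤ ] (lerpᵖ t z w)} {1ℝ} {lerp t (∑[ ⊤ ] z) (∑[ ⊤ ] w)} {lerp t 1ℝ 1ℝ}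
    (∑-lerp ⊤ t z w) one
    (lerp-mono-≤ t {∑[ ⊤ ] z} {1ℝ} {∑[ ⊤ ] w} {1ℝ} z≤1 w≤1) ,
  ≤-resp-≗ {1ℝ} {∑[ ⊤ ] (lerpᵖ t z w)} {lerp t 1ℝ 1ℝ} {lerp t (∑[ ⊤ ] z) (∑[ ⊤ ] w)}
    one (∑-lerp ⊤ t z w)
    (lerp-mono-≤ t {1ℝ} {∑[ ⊤ ] z} {1ℝ} {∑[ ⊤ ] w} z≥1 w≥1)
  where
  ⊤ = Subset.⊤ {m}
  one : seq 1ℝ ≗ seq (lerp t 1ℝ 1ℝ)
  one n = sym (mix-const (seq (real t) n) 1ℚ)

module _ {m : ℕ} (R : Region m) where

  open Region R using (inhabited; contained; connected; maximal)

  infix 4 _≺_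

  -- Extends the arrows of `φ` to arbitrary subsets, in particular to the improper interval, which
  -- is not a vertex of the Golomb graph.
  _≺_ : Subset m → Subset m → Set
  S ≺ T = ∀ z → z ∈ carrier R → ∑[ S ] z < ∑[ T ] z

  -- The two strict inequalities define open sets covering the carrier. If both occurred,
  -- connectedness would give a point satisfying both.
  ≺-spread : ∀ {S T} → (∀ {w} → w ∈ carrier R → ∑[ S ] w # ∑[ T ] w) →
             ∀ {z} → z ∈ carrier R → ∑[ S ] z < ∑[ T ] z → S ≺ T
  ≺-spread {S} {T} apart {z} z∈R z< w w∈R with apart w∈R
  ... | inj₁ w< = w<
  ... | inj₂ w> =
    let v , _ , v< , v> = connected _ _ (∑<∑-open S T) (∑<∑-open T S)
          apart (z , z∈R , z<) (w , w∈R , w>)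
    in ⊥-elim (<-asym {∑[ S ] v} {∑[ T ] v} v< v>)

  ≺-total : ∀ {S T} → Consecutive S → Consecutive T → S ≢ T → S ≺ T ⊎ T ≺ S
  ≺-total {S} {T} cS cT S≢T = let z , z∈R = inhabited in
    Sum.map (≺-spread {S} {T} (λ w∈R → proj₂ (contained w∈R) cS cT S≢T) z∈R)
            (≺-spread {T} {S} (λ w∈R → proj₂ (contained w∈R) cT cS (S≢T ∘ sym)) z∈R)
            (proj₂ (contained z∈R) cS cT S≢T)

  Cell : Pred (Point m) 0ℓ
  Cell z = z ∈ Simplex m ×
    (∀ {S T} → Consecutive S → Consecutive T → S ≺ T → ∑[ S ] z < ∑[ T ] z)

  cell-convex : Convex Cell
  cell-convex {z} {w} (z∈Δ , z<) (w∈Δ , w<) t =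
    simplex-convex m z∈Δ w∈Δ t , λ {S} {T} cS cT S≺T →
    <-resp-≗ {∑[ S ] (lerpᵖ t z w)} {∑[ T ] (lerpᵖ t z w)}
      {lerp t (∑[ S ] z) (∑[ S ] w)} {lerp t (∑[ T ] z) (∑[ T ] w)}
      (∑-lerp S t z w) (∑-lerp T t z w)
      (lerp-mono-< t {∑[ S ] z} {∑[ T ] z} {∑[ S ] w} {∑[ T ] w}
        (z< cS cT S≺T) (w< cS cT S≺T))

  cell⊆complement : Cell ⊆ Simplex m ∩ OffHyperplanes m
  cell⊆complement (z∈Δ , z<) = z∈Δ , λ cU cV U≢V → off cU cV (≺-total cU cV U≢V)
    where
    off : ∀ {U V} → Consecutive U → Consecutive V → U ≺ V ⊎ V ≺ U → _
    off cU cV (inj₁ U≺V) = inj₁ (z< cU cV U≺V)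
    off cU cV (inj₂ V≺U) = inj₂ (z< cV cU V≺U)

  -- The cell is connected, avoids the hyperplanes and contains the carrier, so maximality of the
  -- component absorbs it.
  cell⊆carrier : Cell ⊆ carrier R
  cell⊆carrier = maximal Cell cell⊆complement (convex⇒connected cell-convex)
    λ z∈R → proj₁ (contained z∈R) , λ _ _ S≺T → S≺T _ z∈R

-- The hyperplanes that involve the improper interval are decided by inclusion.
carrier⊆cell : ∀ {m} (R R′ : Region m) → (∀ {U V} → _⟶ᴿ_ R′ U V → _⟶ᴿ_ R U V) →
               carrier R ⊆ Cell R′
carrier⊆cell {m} R R′ R′⇒R {z} z∈R = proj₁ (Region.contained R z∈R) , less
  where
  below-⊤ : ∀ (R : Region m) {S} → Consecutive S → S ≢ Subset.⊤ →
            ∀ {T} → T ≡ Subset.⊤ → Consecutive T →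
            ∀ z → z ∈ carrier R → ∑[ S ] z < ∑[ T ] z
  below-⊤ R {S} cS S≢⊤ refl c⊤ z z∈R with proj₂ (Region.contained R z∈R) cS c⊤ S≢⊤
  ... | inj₁ z< = z<
  ... | inj₂ z> = ⊥-elim (≤⇒≯ {∑[ S ] z} {∑[ Subset.⊤ ] z}
        (∑-⊆ S Subset.⊤ (proj₁ (proj₁ (Region.contained R z∈R)))
          (λ {i} _ → Subset.∈⊤ {x = i})) z>)

  ≺-irrefl : ∀ {S} → ¬ _≺_ R′ S S
  ≺-irrefl {S} S≺S = let w , w∈R′ = Region.inhabited R′ in
    <-irrefl {∑[ S ] w} (S≺S w w∈R′)

  less : ∀ {S T} → Consecutive S → Consecutive T → _≺_ R′ S T → ∑[ S ] z < ∑[ T ] z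
  less {S} {T} cS cT S≺T
    with Vec.≡-dec Bool._≟_ S Subset.⊤ | Vec.≡-dec Bool._≟_ T Subset.⊤
  ... | no S≢⊤   | no T≢⊤  = R′⇒R {mkPC S cS S≢⊤} {mkPC T cT T≢⊤} S≺T z z∈R
  ... | no S≢⊤   | yes T≡⊤ = below-⊤ R {S} cS S≢⊤ {T} T≡⊤ cT z z∈R
  ... | yes refl | yes refl = ⊥-elim (≺-irrefl {Subset.⊤} S≺T)
  -- The improper interval cannot lie below a proper one: a point of `R′` would satisfy both strict
  -- inequalities.
  ... | yes S≡⊤  | no T≢⊤ = let w , w∈R′ = Region.inhabited R′ in
        ⊥-elim (<-asym {∑[ S ] w} {∑[ T ] w} (S≺T w w∈R′)
          (below-⊤ R′ {T} cT T≢⊤ {S} S≡⊤ cS w w∈R′))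

-- Equal orientations place each carrier in the cell of the other region, and that cell lies in the
-- other carrier.
φ-injective : ∀ m → Injective (Setoid._≈_ (Regions m))
  (Setoid._≈_ (CoherentAcyclicOrientations m)) (Func.to (φ m))
φ-injective m {R} {R′} φR≈φR′ =
  (λ z∈R → cell⊆carrier R′ (carrier⊆cell R R′
    (λ {U} {V} → Equivalence.from (φR≈φR′ U V)) z∈R)) ,
  (λ z∈R′ → cell⊆carrier R (carrier⊆cell R′ R
    (λ {U} {V} → Equivalence.to (φR≈φR′ U V)) z∈R′))

-- Finiteness

module _ {a ℓ} (S : Setoid a ℓ) where

  open Setoid S using (Carrier) renaming (_≈_ to _∼_; sym to ∼-sym)

  -- Injectivity cancels the first `i` applications of `g` on both sides. What remains equates `y`
  -- with a positive iterate of itself, whose last application of `g` exhibits a preimage.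
  iterates-collide : ∀ {g : Carrier → Carrier} → Injective _∼_ _∼_ g → ∀ y {i j} →
    i ℕ.< j → fold y g i ∼ fold y g j → ∃[ x ] g x ∼ y
  iterates-collide {g} g-inj y {zero}  {suc j} _           eq = fold y g j , ∼-sym eq
  iterates-collide {g} g-inj y {suc i} {suc j} (ℕ.s≤s i<j) eq =
    iterates-collide g-inj y i<j (g-inj eq)

  -- Among the first `N` + 1 iterates of `y`, two have the same code.
  injective⇒strictlySurjective :
    ∀ {N} (code : Carrier → Fin N) → (∀ {x y} → code x ≡ code y → x ∼ y) →
    ∀ {g} → Injective _∼_ _∼_ g → StrictlySurjective _∼_ g
  injective⇒strictlySurjective {N} code code-inj {g} g-inj y =
    let i , j , i<j , eq = Fin.pigeonhole (ℕ.n<1+n N) (λ k → code (fold y g (toℕ k)))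
    in iterates-collide g-inj y i<j (code-inj eq)

funToFin-injective : ∀ {m n} {f g : Fin m → Fin n} → funToFin f ≡ funToFin g → f ≗ g
funToFin-injective {f = f} {g} eq i = trans (sym (Fin.finToFun-funToFin f i))
  (trans (cong (λ k → Fin.finToFun k i) eq) (Fin.finToFun-funToFin g i))

-- Coding an orientation by a finite table

bit : {A : Set} → Dec A → Fin 2
bit (yes _) = 1F
bit (no  _) = 0F

module _ {m : ℕ} (o : CoherentAcyclicOrientation m) where

  open CoherentAcyclicOrientation o

  -- Totality names one of the two directions between distinct vertices, and asymmetry refutes the
  -- other.
  arrow? : ∀ U V → Dec (U ⟶ V)
  arrow? U@(mkPC S _ _) V@(mkPC T _ _) with Vec.≡-dec Bool._≟_ S T
  ... | yes refl = no λ U⟶V → adjacent U⟶V refl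
  ... | no S≢T with total {U} {V} (λ U≡V → S≢T (cong set U≡V))
  ...   | inj₁ U⟶V = yes U⟶V
  ...   | inj₂ V⟶U = no λ U⟶V → asym U⟶V V⟶U

  -- Stated for bare subsets so that the table has an entry for every choice of endpoints; choices
  -- that give no vertex receive the answer no.
  Arrow : Subset m → Subset m → Set
  Arrow S T = ∃₂ λ U V → set U ≡ S × set V ≡ T × U ⟶ V

  Arrow? : ∀ S T → Dec (Arrow S T)
  Arrow? S T with consecutive? S | Vec.≡-dec Bool._≟_ S Subset.⊤
                | consecutive? T | Vec.≡-dec Bool._≟_ T Subset.⊤
  ... | yes cS | no S≢⊤ | yes cT | no T≢⊤ = map′
    (λ U⟶V → mkPC S cS S≢⊤ , mkPC T cT T≢⊤ , refl , refl , U⟶V)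
    (λ { (mkPC _ _ _ , mkPC _ _ _ , refl , refl , U⟶V) → U⟶V })
    (arrow? (mkPC S cS S≢⊤) (mkPC T cT T≢⊤))
  ... | no ¬cS | _ | _ | _ = no λ { (mkPC _ cS _ , _ , refl , _) →
    ¬cS (recompute (consecutive? S) cS) }
  ... | yes _ | yes S≡⊤ | _ | _ = no λ { (mkPC _ _ S≢⊤ , _ , refl , _) →
    ⊥-elim-irr (S≢⊤ S≡⊤) }
  ... | yes _ | no _ | no ¬cT | _ = no λ { (_ , mkPC _ cT _ , _ , refl , _) →
    ¬cT (recompute (consecutive? T) cT) }
  ... | yes _ | no _ | yes _ | yes T≡⊤ = no λ { (_ , mkPC _ _ T≢⊤ , _ , refl , _) →
    ⊥-elim-irr (T≢⊤ T≡⊤) }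

  arrow-bit : Fin m → Fin m → Fin m → Fin m → Fin 2
  arrow-bit j k j′ k′ = bit (Arrow? [ j ⋯ k ] [ j′ ⋯ k′ ])

  -- The table has one bit for each quadruple of endpoints, and the iterated power counts all such
  -- tables.
  code : Fin ((((2 ℕ.^ m) ℕ.^ m) ℕ.^ m) ℕ.^ m)
  code = funToFin λ j → funToFin λ k → funToFin λ j′ → funToFin λ k′ →
    arrow-bit j k j′ k′

module _ {m : ℕ} (o o′ : CoherentAcyclicOrientation m) where

  open CoherentAcyclicOrientation

  code⇒arrow : code o ≡ code o′ → ∀ U V → _⟶_ o U V → _⟶_ o′ U V
  code⇒arrow eq (mkPC S cS pS) (mkPC T cT pT) U⟶V
    -- The proofs stored in the vertices are irrelevant, so the endpoints are recovered by the
    -- decision procedure.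
    with recompute (consecutive? S) cS | recompute (consecutive? T) cT
  ... | j , k , _ , refl | j′ , k′ , _ , refl = transfer (Arrow? o S T) (Arrow? o′ S T) bits
    where
    bits : arrow-bit o j k j′ k′ ≡ arrow-bit o′ j k j′ k′
    bits = funToFin-injective (funToFin-injective (funToFin-injective
             (funToFin-injective eq j) k) j′) k′
    transfer : (d : Dec (Arrow o S T)) (d′ : Dec (Arrow o′ S T)) →
               bit d ≡ bit d′ →
               _⟶_ o′ (mkPC S cS pS) (mkPC T cT pT)
    transfer _        (yes (mkPC _ _ _ , mkPC _ _ _ , refl , refl , U⟶V′)) _ = U⟶V′
    transfer (no ¬UV) (no _) _  = ⊥-elim (¬UV (_ , _ , refl , refl , U⟶V))
    transfer (yes _)  (no _) ()

code-injective : ∀ {m} {o o′ : CoherentAcyclicOrientation m} → code o ≡ code o′ →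
                 Setoid._≈_ (CoherentAcyclicOrientations m) o o′
code-injective {o = o} {o′} eq U V =
  mk⇔ (code⇒arrow o o′ eq U V) (code⇒arrow o′ o (sym eq) U V)

bijection⇒φ-surjective : ∀ m → Bijection (CoherentAcyclicOrientations m) (Regions m) →
  Surjective (Setoid._≈_ (Regions m)) (Setoid._≈_ (CoherentAcyclicOrientations m))
    (Func.to (φ m))
bijection⇒φ-surjective m f o =
  let o′ , φfo′≈o = injective⇒strictlySurjective Orientations code code-injective
        {λ o → Func.to (φ m) (Bijection.to f o)}
        (λ {o} {o′} eq → Bijection.injective f
          (φ-injective m {Bijection.to f o} {Bijection.to f o′} eq)) o
  -- `Surjective` speaks of every region equal to the chosen preimage, hence the transport along
  -- `Func.cong`.
  in Bijection.to f o′ , λ {R} R≈fo′ →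
    Setoid.trans Orientations {Func.to (φ m) R} {Func.to (φ m) (Bijection.to f o′)} {o}
      (Func.cong (φ m) {R} {Bijection.to f o′} R≈fo′) φfo′≈o
  where Orientations = CoherentAcyclicOrientations m

-- An orientation outside the image of φ

-- For m = 5, interval sums of the weights (4, 1, 7, 6, 3), except that the
-- values 12 of {1,2,3} and 9 of {4,5}, between which no other sum lies, are
-- exchanged.
rank : Subset 5 → ℕ
rank (inside  ∷ inside  ∷ inside  ∷ outside ∷ outside ∷ []) = 9
rank (outside ∷ outside ∷ outside ∷ inside  ∷ inside  ∷ []) = 12
rank S = weight S (4 ∷ 1 ∷ 7 ∷ 6 ∷ 3 ∷ [])
  where
  weight : ∀ {m} → Subset m → Vec ℕ m → ℕ
  weight []            []       = 0
  weight (inside  ∷ S) (w ∷ ws) = w ℕ.+ weight S ws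
  weight (outside ∷ S) (w ∷ ws) = weight S ws

-- Consecutive sets are enumerated by their endpoints, so the properties of `rank` can be settled by
-- evaluation.
∀-consecutive? : ∀ {m} {P : Pred (Subset m) 0ℓ} → (∀ S → Dec (P S)) →
                 Dec (∀ {S} → Consecutive S → P S)
∀-consecutive? P? = map′
  (λ { ∀P (j , k , j≤k , refl) → ∀P j k j≤k })
  (λ ∀P j k j≤k → ∀P (j , k , j≤k , refl))
  (Fin.all? λ j → Fin.all? λ k → (j Fin.≤? k) →-dec P? [ j ⋯ k ])

disjoint? : ∀ {m} (S T : Subset m) → Dec (Disjoint S T)
disjoint? S T = ¬? (Subset.nonempty? (S Subset.∩ T))

opaque

  rank-injective : ∀ {S} → Consecutive S → ∀ {T} → Consecutive T →
                   rank S ≡ rank T → S ≡ T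
  rank-injective = from-yes (∀-consecutive? λ S → ∀-consecutive? λ T →
    (rank S ℕ.≟ rank T) →-dec Vec.≡-dec Bool._≟_ S T)

  rank-mono : ∀ {S} → Consecutive S → ∀ {T} → Consecutive T →
              S Subset.⊂ T → rank S ℕ.< rank T
  rank-mono = from-yes (∀-consecutive? λ S → ∀-consecutive? λ T →
    (S Subset.⊂? T) →-dec (rank S ℕ.<? rank T))

  -- The exchange of {1,2,3} and {4,5} does no harm here. As `U` and `V` they leave no room for a
  -- nonempty `W`, and as the two unions they would have to share `W` although they are disjoint.
  -- All other comparisons are those of the weights.
  rank-∪ :
    ∀ {U} → Consecutive U → ∀ {V} → Consecutive V → ∀ {W} → Consecutive W →
    Disjoint U V → Disjoint U W → Disjoint V W →
    Consecutive (U Subset.∪ W) → Consecutive (V Subset.∪ W) →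
    rank U ℕ.< rank V → rank (U Subset.∪ W) ℕ.< rank (V Subset.∪ W)
  rank-∪ = from-yes (∀-consecutive? λ U → ∀-consecutive? λ V → ∀-consecutive? λ W →
    disjoint? U V →-dec disjoint? U W →-dec disjoint? V W →-dec
    consecutive? (U Subset.∪ W) →-dec consecutive? (V Subset.∪ W) →-dec
    (rank U ℕ.<? rank V) →-dec
    (rank (U Subset.∪ W) ℕ.<? rank (V Subset.∪ W)))

consecutive-set : ∀ {m} (U : ProperConsecutive m) → Consecutive (set U)
consecutive-set (mkPC S cS _) = recompute (consecutive? S) cS

set-injective : ∀ {m} {U V : ProperConsecutive m} → set U ≡ set V → U ≡ V
set-injective {U = mkPC _ _ _} {mkPC _ _ _} refl = refl

interval : ∀ {m} (j k : Fin m) {_ : True (j Fin.≤? k)}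
           {_ : False (Vec.≡-dec Bool._≟_ [ j ⋯ k ] Subset.⊤)} → ProperConsecutive m
interval j k {j≤k} {proper} =
  mkPC [ j ⋯ k ] (j , k , toWitness j≤k , refl) (toWitnessFalse proper)

rank-orientation : Orientation (Golomb 5)
rank-orientation = record
  { _⟶_      = λ U V → rank (set U) ℕ.< rank (set V)
  ; adjacent = λ { U<U refl → ℕ.<-irrefl refl U<U }
  ; total    = λ {U} {V} → total {U} {V}
  ; asym     = ℕ.<-asym
  }
  where
  total : ∀ {U V} → U ≢ V →
          rank (set U) ℕ.< rank (set V) ⊎ rank (set V) ℕ.< rank (set U)
  total {U} {V} U≢V with ℕ.<-cmp (rank (set U)) (rank (set V))
  ... | tri< U<V _ _ = inj₁ U<V
  ... | tri≈ _ U≡V _ = ⊥-elim (U≢V (set-injective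
          (rank-injective (consecutive-set U) (consecutive-set V) U≡V)))
  ... | tri> _ _ V<U = inj₂ V<U

disjoint-sym : ∀ {m} {S T : Subset m} → Disjoint S T → Disjoint T S
disjoint-sym {S = S} {T} = subst Subset.Empty (Subset.∩-comm S T)

rank-coherent : Coherent rank-orientation
rank-coherent = record
  { consistent = λ {U} {V} → rank-mono (consecutive-set U) (consecutive-set V)
  ; cancel     = λ {U} {V} {W} {A} {B} → cancel {U} {V} {W} {A} {B}
  }
  where
  cancel : ∀ {U V W A B} →
    Disjoint (set U) (set V) → Disjoint (set U) (set W) → Disjoint (set V) (set W) →
    set A ≡ set U Subset.∪ set W → set B ≡ set V Subset.∪ set W →
    rank (set A) ℕ.< rank (set B) ⇔ rank (set U) ℕ.< rank (set V)
  cancel {U} {V} {W} {A} {B} UV UW VW A≡ B≡ = mk⇔ to from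
    where
    cU = consecutive-set U
    cV = consecutive-set V
    cW = consecutive-set W
    cA = subst Consecutive A≡ (consecutive-set A)
    cB = subst Consecutive B≡ (consecutive-set B)
    from : rank (set U) ℕ.< rank (set V) → rank (set A) ℕ.< rank (set B)
    from U<V = subst₂ (λ S T → rank S ℕ.< rank T) (sym A≡) (sym B≡)
      (rank-∪ cU cV cW UV UW VW cA cB U<V)
    to : rank (set A) ℕ.< rank (set B) → rank (set U) ℕ.< rank (set V)
    -- Only one implication is checked by evaluation; the converse is that implication with `U` and
    -- `V` exchanged, by trichotomy.
    to A<B with ℕ.<-cmp (rank (set U)) (rank (set V))
    ... | tri< U<V _ _ = U<V
    ... | tri≈ _ U≡V _ = contradiction A<B (ℕ.<-irrefl (cong rank A≡B))
      where
      A≡B : set A ≡ set B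
      A≡B = trans A≡ (trans (cong (Subset._∪ set W) (rank-injective cU cV U≡V)) (sym B≡))
    ... | tri> _ _ V<U = contradiction A<B (ℕ.<-asym
      (subst₂ (λ S T → rank S ℕ.< rank T) (sym B≡) (sym A≡)
        (rank-∪ cV cU cW (disjoint-sym {S = set U} UV) VW UW cB cA V<U)))

-- The rank strictly increases along a walk, so no walk can close up.
rank-acyclic : Acyclic rank-orientation
rank-acyclic U⟶⁺U = ℕ.<-irrefl refl (walk U⟶⁺U)
  where
  open Orientation rank-orientation
  walk : ∀ {U V} → TransClosure _⟶_ U V → rank (set U) ℕ.< rank (set V)
  walk [ U⟶V ]                   = U⟶V
  walk {U} {W} (_∷_ {y = V} U⟶V V⟶⁺W) =
    ℕ.<-trans {rank (set U)} {rank (set V)} {rank (set W)} U⟶V (walk V⟶⁺W)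

rank-cao : CoherentAcyclicOrientation 5
rank-cao = record
  { orientation = rank-orientation
  ; coherent    = rank-coherent
  ; acyclic     = rank-acyclic
  }

+-mono-< : ∀ {x y u v} → x < y → u < v → x + u < y + v
+-mono-< {x} {y} {u} {v} (ε , 0<ε , x<y) (δ , 0<δ , u<v) =
  ε ℚ.+ δ , +-pos 0<ε 0<δ , eventually₂ bound x<y u<v
  where
  bound : ∀ n → seq x n ℚ.+ ε ℚ.≤ seq y n → seq u n ℚ.+ δ ℚ.≤ seq v n →
          (seq x n ℚ.+ seq u n) ℚ.+ (ε ℚ.+ δ) ℚ.≤ seq y n ℚ.+ seq v n
  bound n p q = subst (ℚ._≤ seq y n ℚ.+ seq v n)
    (interchange (seq x n) ε (seq u n) δ) (ℚ.+-mono-≤ p q)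

-- z₄ < z₃ and z₅ < z₁ + z₂ contradict z₁ + z₂ + z₃ < z₄ + z₅.
rank-unrealizable : ∀ R →
  ¬ Setoid._≈_ (CoherentAcyclicOrientations 5) (Func.to (φ 5) R) rank-cao
rank-unrealizable R φR≈ = <-asym {∑[ set [45] ] z} {∑[ set [123] ] z}
  (<-resp-≗ {∑[ set [45] ] z} {∑[ set [123] ] z}
    {∑[ set [4] ] z + ∑[ set [5] ] z} {∑[ set [3] ] z + ∑[ set [12] ] z}
    (∑-∪ (set [4]) (set [5]) z (from-yes (disjoint? (set [4]) (set [5]))))
    (∑-∪ (set [3]) (set [12]) z (from-yes (disjoint? (set [3]) (set [12]))))
    (+-mono-< {∑[ set [4] ] z} {∑[ set [3] ] z} {∑[ set [5] ] z} {∑[ set [12] ] z}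
      (less [4] [3] (from-yes (6 ℕ.<? 7))) (less [5] [12] (from-yes (3 ℕ.<? 5)))))
  -- These are the exchanged values: 9 is the rank of {1,2,3} and 12 that of {4,5}.
  (less [123] [45] (from-yes (9 ℕ.<? 12)))
  where
  z = proj₁ (Region.inhabited R)
  less : ∀ U V → rank (set U) ℕ.< rank (set V) → ∑[ set U ] z < ∑[ set V ] z
  less U V U<V = Equivalence.from (φR≈ U V) U<V z (proj₂ (Region.inhabited R))
  -- The names list elements counted from one, whereas `Fin` counts from zero.
  [3] [4] [5] [12] [45] [123] : ProperConsecutive 5
  [3]   = interval 2F 2F
  [4]   = interval 3F 3F
  [5]   = interval 4F 4F
  [12]  = interval 0F 1F
  [45]  = interval 3F 4F
  [123] = interval 0F 2F

φ-not-surjective : ¬ Surjective (Setoid._≈_ (Regions 5))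
  (Setoid._≈_ (CoherentAcyclicOrientations 5)) (Func.to (φ 5))
φ-not-surjective φ-surjective = rank-unrealizable R
  (φR≈ {R} (Setoid.refl (Regions 5) {R}))
  where
  R = proj₁ (φ-surjective rank-cao)
  φR≈ = proj₂ (φ-surjective rank-cao)

proposition4p2 : ¬ Surjective (Setoid._≈_ (Regions 5)) (Setoid._≈_ (CoherentAcyclicOrientations 5)) (Func.to (φ 5))
    × ¬ Bijection (CoherentAcyclicOrientations 5) (Regions 5)
proposition4p2 = φ-not-surjective , λ f → φ-not-surjective (bijection⇒φ-surjective 5 f)
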